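{- Let $L$ be a skew basic $(p,q)$-leaper, $p<q$, $C$ a cycle of $L$ within a $(p+q)\times(p+q)$ chessboard, and $e$ the descent of $C$. Then $C$ is trivial and the direction graph extracted from $C$ depends only on $e$ (that is, cycles of the same descent $e$ of any two skew basic leapers, each within its own board of this kind, have the same extracted direction graph). Equivalently, let $C$ be a cycle of type $k$. Then the direction graph extracted from $C$ depends only on the $k$-th convergent $[c_1\pm,c_2\pm,\ldots,c_k]$ of the even continued fraction representation of $\frac qp$.
   Context: Leapers. A square is a unit square of the infinite chessboard. A $(p,q)$-leaper is a piece that moves from a square $a$ to any of $a+(\pm p,\pm q)$, $a+(\pm q,\pm p)$. The leaper graph of $L$ over a set of squares $B$ has the squares of $B$ as vertices, two being adjacent when a move of $L$ joins them; a cycle of $L$ within $B$ is a simple cycle in this graph. The leaper is basic if $p+q$ is odd and $\gcd(p,q)=1$, and skew if $p,q$ are nonzero and distinct. Frames. Let $m<n$ be coprime positive integers with $m+n$ odd. Identify squares with their centers, the centers being the points of $\mathbb Z^2$. The $(m,n)$-frame $F$ is the set of squares $(x,y)$ with $\frac{n-m}2<\max(|x|,|y|)<\frac{m+n}2$, i.e. an $(m+n)\times(m+n)$ board with an $(n-m)\times(n-m)$ central hole. Its section $F_{\mathtt E}$ consists of the squares with $\frac{n-m}2<x<\frac{m+n}2$, $|y|<\frac{n-m}2$; its section $F_{\mathtt{NE}}$ of those with $\frac{n-m}2<x,y<\frac{m+n}2$; the sections $F_{\mathtt N},F_{\mathtt{NW}},F_{\mathtt W},F_{\mathtt{SW}},F_{\mathtt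 S},F_{\mathtt{SE}}$ are obtained by counterclockwise rotations by multiples of $90^\circ$ about the origin. In the leaper graph of the $(m,n)$-leaper over the $(m+n)\times(m+n)$ board the squares of the hole are isolated and all squares of $F$ have degree two, so a cycle is determined by its vertex set. Lifting. The lifting transformations $\mathtt f,\mathtt g,\mathtt h$ take $S\subseteq F$ to the disjoint union of $(S+v_i)\cap H_i$ over the eight directions $i$, where $H$ is respectively the $(m,2m+n)$-, $(n,2n-m)$-, $(n,m+2n)$-frame, and for $\mathtt f$: $v_{\mathtt E}=(m+n,0)$, $v_{\mathtt{NE}}=(m,m)$; for $\mathtt g$: $v_{\mathtt E}=(n-m,0)$, $v_{\mathtt{NE}}=(n,n)$; for $\mathtt h$: $v_{\mathtt E}=(m+n,0)$, $v_{\mathtt{NE}}=(n,n)$; the other $v_i$ are obtained by $90^\circ$ rotations. Each maps the vertex set of a cycle of the $(m,n)$-leaper within $F$ to the vertex set of a cycle of the leaper with the proportions of $H$ within $H$; this defines the lift of a cycle. Shell. Let $n\le3m$. If $2m\ge n$, the shell of $F$ is the union of eight $(n-m)\times(n-m)$ subboards: the four corners of $F$ and the four adjacent by side to the central hole. If $2m\le n\le3m$, it is the union of eight $(3m-n)\times(3m-n)$ subboards: one in the middle of each outer side and four adjacent by corner to the central hole. (When $n=2m$ both give all of $F$.) The shell is a union of eight-square cycles of the $(m,n)$-leaper, called shell cycles. Descents. The descent of a skew basic $(p,q)$-leaper, $p<q$, is the unique string $e_1\ldots e_l$ of characters $\mathtt f,\mathtt g,\mathtt h$ such that successively applying lifting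 transformations of types $e_l,\ldots,e_1$ to a $(1,2)$-frame gives a $(p,q)$-frame. The descent of a cycle $C$ of $L$ within a $(p+q)\times(p+q)$ board is the prefix $e_1\ldots e_j$ of the descent of $L$ such that $C$ is obtained from a shell cycle (of the frame whose leaper has descent $e_{j+1}\ldots e_l$) by successively applying lifting transformations of types $e_j,\ldots,e_1$. Even continued fractions and types. $[c_1\pm,\ldots,c_K]=c_1\pm\cfrac1{c_2\pm\cfrac1{\ddots\pm\frac1{c_K}}}$, with independent signs, all $c_i$ even integers, $c_1\ge0$, $c_2,\ldots,c_K>0$; every $\frac qp$ with $p,q$ coprime and $p+q$ odd has a unique such representation, and its $k$-th convergent is $[c_1\pm,\ldots,c_k]$ with the same signs. The descent of $L$ is $\mathtt f^{c_1/2-1}x_1\mathtt f^{c_2/2-1}x_2\cdots x_{K-1}\mathtt f^{c_K/2-1}$, where $x_i=\mathtt g$ if the sign following $c_i$ is $-$ and $x_i=\mathtt h$ if it is $+$. A cycle $C$ is of type $k$, $1\le k\le K$, if its descent is $\mathtt f^{c_1/2-1}x_1\cdots x_{k-1}\mathtt f^{c_k/2-1}$. Direction graphs. Let $A_1=\begin{pmatrix}0&1\\1&0\end{pmatrix}$, $A_2=\begin{pmatrix}1&0\\0&1\end{pmatrix}$, $A_3=\begin{pmatrix}-1&0\\0&1\end{pmatrix}$, $A_4=\begin{pmatrix}0&-1\\1&0\end{pmatrix}$, and $A_{i+4}=-A_i$ for $i=1,\ldots,4$. A move of a skew $(p,q)$-leaper, $p<q$, by a translation $v$ has (skew) direction $i\in\{1,\ldots,8\}$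 and direction matrix $A_i$ if $v^T=A_i\binom pq$. A direction graph is a symmetric directed graph whose arcs are labeled with skew directions so that the sum of the associated direction matrices over every simple directed cycle (including two-cycles) is zero. Two direction graphs are the same if there is a label-preserving isomorphism between them. A simple cycle of a skew leaper is trivial if the sum of the direction matrices of its moves (in either orientation) is the zero matrix. The direction graph extracted from a trivial cycle $C$ has the squares of $C$ as vertices and, for each pair of squares $a,b$ consecutive in $C$, an arc from $a$ to $b$ labeled with the direction of the move from $a$ to $b$ and an arc from $b$ to $a$ labeled with the direction of the move from $b$ to $a$. -}

module Defs where

open import Data.Fin using (Fin; toℕ)
open import Data.Fin.Patterns using (0F; 1F; 2F; 3F; 4F; 5F; 6F; 7F)
open import Data.Integer as ℤ using (ℤ; 0ℤ; 1ℤ; -1ℤ; _◃_)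
open import Data.List using (List; []; _∷_; _++_; foldr; length; replicate; take)
open import Data.List.Relation.Unary.All using (All)
open import Data.Nat as ℕ using (ℕ; suc; _≤_; _<_)
open import Data.Nat.Divisibility using (_∣_)
open import Data.Nat.DivMod using (_%_; _mod_)
open import Data.Nat.GCD using (gcd)
open import Data.Nat.GeneralisedArithmetic using (iterate)
open import Data.Product using (∃-syntax; _×_; _,_; proj₁)
open import Data.Rational as ℚ using (ℚ; mkℚ; 0ℚ)
open import Data.Sign using (Sign)
open import Data.Sum using (_⊎_)
import Data.Vec.Functional as Vector
open import Function.Base using (_∘_)
open import Function.Bundles using (_↔_; _⇔_; Inverse)
open import Function.Definitions using (Injective)
open import Relation.Binary.PropositionalEquality using (_≡_; _≢_)
open import Relation.Unary using (Pred; _∈_)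
open import Level using (0ℓ)

------------------------------------------------------------------------
-- Squares and leapers

Square : Set
Square = ℤ × ℤ

infixl 6 _⊕_ _⊖_

_⊕_ _⊖_ : Square → Square → Square
(x , y) ⊕ (x′ , y′) = x ℤ.+ x′ , y ℤ.+ y′
(x , y) ⊖ (x′ , y′) = x ℤ.- x′ , y ℤ.- y′

Basic : ℕ → ℕ → Set
Basic p q = (p ℕ.+ q) % 2 ≡ 1 × gcd p q ≡ 1

Skew : ℕ → ℕ → Set
Skew p q = p ≢ 0 × q ≢ 0 × p ≢ q

record Leaper : Set where
  field
    p q   : ℕ
    p<q   : p < q
    basic : Basic p q
    skew  : Skew p q

Adjacent : (p q : ℕ) → Square → Square → Set
Adjacent p q a b = ∃[ s ] ∃[ t ]
  (b ≡ a ⊕ (s ◃ p , t ◃ q) ⊎ b ≡ a ⊕ (s ◃ q , t ◃ p))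

next : ∀ {n} → Fin n → Fin n
next {suc n} i = suc (toℕ i) mod suc n

-- A simple cycle of the (p , q)-leaper, given by its squares in cyclic order
-- (so with a choice of starting square and orientation).
record Cycle (p q : ℕ) : Set where
  field
    size      : ℕ
    square    : Fin size → Square
    3≤size    : 3 ≤ size
    injective : Injective _≡_ _≡_ square
    adjacent  : ∀ i → Adjacent p q (square i) (square (next i))

squares : ∀ {p q} → Cycle p q → Pred Square 0ℓ
squares C s = ∃[ i ] Cycle.square C i ≡ s

------------------------------------------------------------------------
-- Boards, frames and their sections

-- The bounds are twice the coordinates.
Rectangle : (a b c d : ℤ) → Pred Square 0ℓ
Rectangle a b c d (x , y) =
  (a ℤ.< ℤ.+ 2 ℤ.* x × ℤ.+ 2 ℤ.* x ℤ.< b) × (c ℤ.< ℤ.+ 2 ℤ.* y × ℤ.+ 2 ℤ.* y ℤ.< d)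

-- The board of the given odd side centred at the origin.
Board : ℕ → Pred Square 0ℓ
Board side = Rectangle (ℤ.- ℤ.+ side) (ℤ.+ side) (ℤ.- ℤ.+ side) (ℤ.+ side)

-- Rotations by 90° about the origin.
ccw cw : Square → Square
ccw (x , y) = ℤ.- y , x
cw  (x , y) = y , ℤ.- x

rotate unrotate : Fin 4 → Square → Square
rotate   k s = iterate ccw s (toℕ k)
unrotate k s = iterate cw s (toℕ k)

-- The eight directions: (edge , k) and (corner , k) are E and NE rotated
-- counterclockwise k times.
data Kind : Set where
  edge corner : Kind

Compass : Set
Compass = Kind × Fin 4

Proportions : Set
Proportions = ℕ × ℕ

baseSection : Proportions → Kind → Pred Square 0ℓ
baseSection (m , n) edge   = Rectangle (n ℤ.⊖ m) (ℤ.+ (m ℕ.+ n)) (m ℤ.⊖ n) (n ℤ.⊖ m)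
baseSection (m , n) corner = Rectangle (n ℤ.⊖ m) (ℤ.+ (m ℕ.+ n)) (n ℤ.⊖ m) (ℤ.+ (m ℕ.+ n))

section : Proportions → Compass → Pred Square 0ℓ
section F (κ , k) s = unrotate k s ∈ baseSection F κ

-- In each case the E (or N, W, S) subboards come first and the corner ones second.
Shell : Proportions → Pred Square 0ℓ
Shell (m , n) s =
  (n ≤ 2 ℕ.* m × ∃[ k ]
    ( unrotate k s ∈ Rectangle (n ℤ.⊖ m) (ℤ.+ 3 ℤ.* (n ℤ.⊖ m)) (m ℤ.⊖ n) (n ℤ.⊖ m)
    ⊎ unrotate k s ∈ Rectangle (3 ℕ.* m ℤ.⊖ n) (ℤ.+ (m ℕ.+ n)) (3 ℕ.* m ℤ.⊖ n) (ℤ.+ (m ℕ.+ n))))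
  ⊎
  ((2 ℕ.* m ≤ n × n ≤ 3 ℕ.* m) × ∃[ k ]
    ( unrotate k s ∈ Rectangle (3 ℕ.* n ℤ.⊖ 5 ℕ.* m) (ℤ.+ (m ℕ.+ n)) (n ℤ.⊖ 3 ℕ.* m) (3 ℕ.* m ℤ.⊖ n)
    ⊎ unrotate k s ∈ Rectangle (n ℤ.⊖ m) (5 ℕ.* m ℤ.⊖ n) (n ℤ.⊖ m) (5 ℕ.* m ℤ.⊖ n)))

IsShellCycle : ∀ {m n} → Cycle m n → Set
IsShellCycle {m} {n} C =
  n ≤ 3 ℕ.* m × Cycle.size C ≡ 8 × (∀ i → Cycle.square C i ∈ Shell (m , n))

------------------------------------------------------------------------
-- Lifting and descents

data Lifting : Set where
  f g h : Lifting

liftFrame : Lifting → Proportions → Proportions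
liftFrame f (m , n) = m , 2 ℕ.* m ℕ.+ n
liftFrame g (m , n) = n , 2 ℕ.* n ℕ.∸ m
liftFrame h (m , n) = n , m ℕ.+ 2 ℕ.* n

baseShift : Lifting → Proportions → Kind → Square
baseShift f (m , n) edge   = ℤ.+ (m ℕ.+ n) , 0ℤ
baseShift f (m , n) corner = ℤ.+ m , ℤ.+ m
baseShift g (m , n) edge   = n ℤ.⊖ m , 0ℤ
baseShift g (m , n) corner = ℤ.+ n , ℤ.+ n
baseShift h (m , n) edge   = ℤ.+ (m ℕ.+ n) , 0ℤ
baseShift h (m , n) corner = ℤ.+ n , ℤ.+ n

shift : Lifting → Proportions → Compass → Square
shift t F (κ , k) = rotate k (baseShift t F κ)

lift : Lifting → Proportions → Pred Square 0ℓ → Pred Square 0ℓ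
lift t F S s = ∃[ i ] (s ∈ section (liftFrame t F) i × s ⊖ shift t F i ∈ S)

-- In a string e₁ … eⱼ, the transformation eⱼ is applied first and e₁ last.
liftFrames : List Lifting → Proportions → Proportions
liftFrames e F = foldr liftFrame F e

lifts : List Lifting → Proportions → Pred Square 0ℓ → Pred Square 0ℓ
lifts []      F S = S
lifts (t ∷ e) F S = lift t (liftFrames e F) (lifts e F S)

IsLeaperDescent : ℕ → ℕ → List Lifting → Set
IsLeaperDescent p q w = liftFrames w (1 , 2) ≡ (p , q)

record BoardCycle (L : Leaper) : Set where
  open Leaper L
  field
    centre : Square
    cycle  : Cycle p q
    within : ∀ i → Cycle.square cycle i ⊖ centre ∈ Board (p ℕ.+ q)

record IsDescent {L : Leaper} (C : BoardCycle L) (e : List Lifting) : Set where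
  open Leaper L
  open BoardCycle C
  field
    m n            : ℕ
    rest           : List Lifting
    leaper-descent : IsLeaperDescent p q (e ++ rest)
    shell-descent  : IsLeaperDescent m n rest
    shell          : Cycle m n
    isShell        : IsShellCycle shell
    lifted         : ∀ s → squares cycle (s ⊕ centre) ⇔ lifts e (m , n) (squares shell) s

------------------------------------------------------------------------
-- Even continued fractions and types

-- [ c₁ ± , … , c_K ]: each later term is stored with the sign preceding it.
record ContinuedFraction : Set where
  constructor cf
  field
    head : ℕ
    tail : List (Sign × ℕ)

IsEven : ContinuedFraction → Set
IsEven (cf c cs) = 2 ∣ c × All (λ (_ , c′) → 2 ∣ c′ × 0 < c′) cs

-- Only applied to positive rationals when the continued fraction is even;
-- the value at 0 is a convention.
reciprocal : ℚ → ℚ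
reciprocal (mkℚ (ℤ.+ 0) _ _)       = 0ℚ
reciprocal r@(mkℚ ℤ.+[1+ _ ] _ _)  = ℚ.1/ r
reciprocal r@(mkℚ ℤ.-[1+ _ ] _ _)  = ℚ.1/ r

addSigned : Sign → ℚ → ℚ → ℚ
addSigned Sign.+ r t = r ℚ.+ t
addSigned Sign.- r t = r ℚ.- t

value : ContinuedFraction → ℚ
value (cf c cs) = go c cs
  where
  go : ℕ → List (Sign × ℕ) → ℚ
  go c []              = ℤ.+ c ℚ./ 1
  go c ((s , c′) ∷ cs) = addSigned s (ℤ.+ c ℚ./ 1) (reciprocal (go c′ cs))

ratio : Leaper → ℚ
ratio L = (ℤ.+ q ℚ./ p) ⦃ ℕ.≢-nonZero (proj₁ skew) ⦄
  where open Leaper L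

Represents : ContinuedFraction → Leaper → Set
Represents c L = IsEven c × value c ≡ ratio L

terms : ContinuedFraction → ℕ
terms (cf _ cs) = suc (length cs)

convergent : ℕ → ContinuedFraction → ContinuedFraction
convergent k (cf c cs) = cf c (take (k ℕ.∸ 1) cs)

signLifting : Sign → Lifting
signLifting Sign.+ = h
signLifting Sign.- = g

-- f^(c₁/2-1) x₁ f^(c₂/2-1) x₂ ⋯ .  For even continued fractions of q/p with
-- p < q also c₁ ≥ 2, so the subtractions are not truncated.
descentString : ContinuedFraction → List Lifting
descentString (cf c cs) = go c cs
  where
  fs : ℕ → List Lifting
  fs c = replicate (c ℕ./ 2 ℕ.∸ 1) f
  go : ℕ → List (Sign × ℕ) → List Lifting
  go c []              = fs c
  go c ((s , c′) ∷ cs) = fs c ++ signLifting s ∷ go c′ cs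

IsType : ∀ {L} → ContinuedFraction → ℕ → BoardCycle L → Set
IsType c k C = (1 ≤ k × k ≤ terms c) × IsDescent C (descentString (convergent k c))

------------------------------------------------------------------------
-- Direction matrices and direction graphs

record Matrix : Set where
  constructor mat
  field
    a₁₁ a₁₂ a₂₁ a₂₂ : ℤ

infixl 6 _+ᴹ_

_+ᴹ_ : Matrix → Matrix → Matrix
mat a b c d +ᴹ mat a′ b′ c′ d′ = mat (a ℤ.+ a′) (b ℤ.+ b′) (c ℤ.+ c′) (d ℤ.+ d′)

-ᴹ_ : Matrix → Matrix
-ᴹ mat a b c d = mat (ℤ.- a) (ℤ.- b) (ℤ.- c) (ℤ.- d)

0ᴹ : Matrix
0ᴹ = mat 0ℤ 0ℤ 0ℤ 0ℤ

sumᴹ : ∀ {n} → (Fin n → Matrix) → Matrix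
sumᴹ = Vector.foldr _+ᴹ_ 0ᴹ

_·_ : Matrix → ℤ × ℤ → ℤ × ℤ
mat a b c d · (x , y) = a ℤ.* x ℤ.+ b ℤ.* y , c ℤ.* x ℤ.+ d ℤ.* y

-- Direction i ∈ {1 , … , 8} is represented by i - 1.
Direction : Set
Direction = Fin 8

A : Direction → Matrix
A 0F = mat 0ℤ 1ℤ 1ℤ 0ℤ
A 1F = mat 1ℤ 0ℤ 0ℤ 1ℤ
A 2F = mat -1ℤ 0ℤ 0ℤ 1ℤ
A 3F = mat 0ℤ -1ℤ 1ℤ 0ℤ
A 4F = -ᴹ A 0F
A 5F = -ᴹ A 1F
A 6F = -ᴹ A 2F
A 7F = -ᴹ A 3F

HasDirection : (p q : ℕ) → Square → Square → Direction → Set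
HasDirection p q a b i = b ⊖ a ≡ A i · (ℤ.+ p , ℤ.+ q)

Trivial : ∀ {p q} → Cycle p q → Set
Trivial {p} {q} C = ∃[ d ]
  ((∀ i → HasDirection p q (square i) (square (next i)) (d i)) × sumᴹ (A ∘ d) ≡ 0ᴹ)
  where open Cycle C

record LabelledDigraph : Set₁ where
  field
    Vertex : Set
    Arc    : Vertex → Vertex → Direction → Set

record IsDirectionGraph (G : LabelledDigraph) : Set where
  open LabelledDigraph G
  field
    symmetric    : ∀ {a b i} → Arc a b i → ∃[ j ] Arc b a j
    unique-label : ∀ {a b i j} → Arc a b i → Arc a b j → i ≡ j
    balanced     : ∀ n (v : Fin (suc n) → Vertex) (d : Fin (suc n) → Direction) →
                   Injective _≡_ _≡_ v → (∀ i → Arc (v i) (v (next i)) (d i)) →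
                   sumᴹ (A ∘ d) ≡ 0ᴹ

record _≅_ (G G′ : LabelledDigraph) : Set where
  private
    module G  = LabelledDigraph G
    module G′ = LabelledDigraph G′
  field
    vertices : G.Vertex ↔ G′.Vertex
    arcs     : ∀ a b i →
               G.Arc a b i ⇔ G′.Arc (Inverse.to vertices a) (Inverse.to vertices b) i

-- The vertices are the positions along C, which correspond to its squares
-- because a cycle does not repeat a square.
extracted : ∀ {p q} → Cycle p q → LabelledDigraph
extracted {p} {q} C = record
  { Vertex = Fin size
  ; Arc    = λ a b i → (b ≡ next a ⊎ a ≡ next b) × HasDirection p q (square a) (square b) i
  }
  where open Cycle C

{-# OPTIONS --safe #-}
module Submission where

-- Relative to a fixed square, a square is written as X · (p , q) with an integer
-- matrix X, so that a move of direction i should add A i to X.  Once the squares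
-- of the board carry matrices with this property, the direction matrices along
-- every closed walk telescope to zero (closed-walk).  This gives both the
-- triviality of a cycle and the balance of its extracted graph.
--
-- The matrices are built along the liftings.  By a form of Euclid's algorithm the
-- frame of every basic leaper arises from the (0 , 1)-frame, whose board is a
-- single square (descend); the (1 , 2)-frame is already a lift of it.  Expressed
-- in the proportions of the new frame, the shift into the section c is V c · (p , q),
-- with the same matrix V c for f, g and h.  So when a square of the old frame
-- has the matrix X, its lift into the section c receives X *ᴹ T t +ᴹ V c, where
-- T t expresses the old proportions through the new ones.  A move in the new
-- frame joins either two lifts of one old square or lifts of two old squares
-- joined by a move (moves-descend), and in both cases the matrices differ by
-- the correct A i (coordinates-move).
--
-- A shell cycle consists of the eight lifts of one square of the hole of the
-- previous frame (eight-squares).  Hence the squares of a cycle with descent e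
-- are those whose matrices, counted from that square, belong to a set Reach e
-- that is defined by e alone (lifts⇒reach, reach⇒lifts).  As every square has
-- at most two neighbours on the board, consecutive squares of the cycle are
-- exactly those whose matrices differ by some A i.  So Reach e determines the
-- extracted graph (charts⇒≅).
--
-- The inequalities between the bounds of sections, shells and holes state that some
-- linear form in the proportions (m , n) is nonpositive for 0 ≤ m ≤ n.  This
-- holds when it is nonpositive at (0 , 1) and (1 , 1), so that the finitely many
-- inequalities needed are decided by computation.
--
-- Finally, an even continued fraction is determined by its value: the part after
-- the head lies strictly between -1 and 1, and the heads are even
-- (value-injective).  So equal convergents have equal descents.

open import Defs
open import Algebra.Properties.AbelianGroup using (∙-cancelˡ; ∙-cancelʳ)
open import Data.Fin as Fin using (Fin; toℕ; fromℕ; inject₁; punchOut; _↑ˡ_; _↑ʳ_)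
open import Data.Fin.Induction using (<-weakInduction)
open import Data.Fin.Patterns using (0F; 1F; 2F; 3F; 4F; 5F; 6F; 7F)
import Data.Fin.Properties as Fin
open import Data.Fin.Properties using (all?; any?)
open import Data.Fin.Relation.Unary.Top using (view; ‵fromℕ; ‵inject₁)
open import Data.Integer as ℤ using (ℤ; 0ℤ; 1ℤ; -1ℤ; _◃_)
import Data.Integer.Properties as ℤ
open import Data.Integer.Tactic.RingSolver using (solve-∀)
open import Data.List using (List; []; _∷_; _++_)
open import Data.List.Properties using (foldr-++)
open import Data.List.Relation.Unary.All using (All; []; _∷_)
import Data.List.Relation.Unary.All.Properties as All
open import Data.Nat as ℕ using (ℕ; suc; zero; _≤_; _<_; z≤n; s≤s)
open import Data.Nat.Divisibility
  using (_∣_; divides; divides-refl; ∣-refl; _∣0; ∣1⇒≡1; ∣m∣n⇒∣m+n; ∣m+n∣m⇒∣n; ∣n⇒∣m*n; m∣m*n;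
         n∣m⇒m%n≡0)
open import Data.Nat.DivMod using (m%n<n; m<n⇒m%n≡m; n%n≡0)
open import Data.Nat.GCD using (gcd-greatest)
open import Data.Nat.GeneralisedArithmetic using (fold; iterate)
open import Data.Nat.Induction using (<-wellFounded)
import Data.Nat.Properties as ℕ
import Data.Nat.Tactic.RingSolver as ℕ-Solver
open import Data.Product using (∃-syntax; _×_; _,_; proj₁; proj₂)
open import Data.Product.Properties using (≡-dec)
open import Data.Rational as ℚ using (ℚ; mkℚ; 0ℚ; 1ℚ)
import Data.Rational.Properties as ℚ
import Data.Rational.Unnormalised as ℚᵘ
import Data.Rational.Unnormalised.Properties as ℚᵘ
open import Data.Sign using (Sign)
open import Data.Sum using (_⊎_; inj₁; inj₂; swap)
open import Function.Base using (_∘_)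
open import Function.Bundles using (_⇔_; mk⇔; Equivalence; mk↔ₛ′)
open import Function.Definitions using (Injective)
open import Induction.WellFounded using (Acc; acc)
open import Level using (0ℓ)
open import Relation.Binary using (tri<; tri≈; tri>)
open import Relation.Binary.PropositionalEquality
open import Relation.Nullary using (¬_; Dec; yes; no; contradiction)
open import Relation.Nullary.Decidable using (map′; ¬?; _×-dec_; _⊎-dec_; _→-dec_; toWitness)
open import Relation.Unary using (Pred; _∈_)

------------------------------------------------------------------------
-- Linear forms and matrices

pattern +2 = ℤ.+[1+ 1 ]

-- (a , b) stands for the linear form a x + b y; a row of a matrix is a form.
Form : Set
Form = ℤ × ℤ

infix 8 ⟪_⟫_

⟪_⟫_ : Form → Square → ℤ
⟪ a , b ⟫ (x , y) = a ℤ.* x ℤ.+ b ℤ.* y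

row₁ row₂ : Matrix → Form
row₁ (mat a b c d) = a , b
row₂ (mat a b c d) = c , d

infixl 7 _∙_ _*ᴹ_

-- Row vector times matrix.
_∙_ : Form → Matrix → Form
(a , b) ∙ mat p q r s = a ℤ.* p ℤ.+ b ℤ.* r , a ℤ.* q ℤ.+ b ℤ.* s

_*ᴹ_ : Matrix → Matrix → Matrix
M *ᴹ N = mat (proj₁ r) (proj₂ r) (proj₁ s) (proj₂ s)
  where
  r = row₁ M ∙ N
  s = row₂ M ∙ N

1ᴹ : Matrix
1ᴹ = mat 1ℤ 0ℤ 0ℤ 1ℤ

mat≡ : ∀ {a b c d a′ b′ c′ d′} → a ≡ a′ → b ≡ b′ → c ≡ c′ → d ≡ d′ →
       mat a b c d ≡ mat a′ b′ c′ d′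
mat≡ refl refl refl refl = refl

_≟ᴹ_ : (M N : Matrix) → Dec (M ≡ N)
mat a b c d ≟ᴹ mat a′ b′ c′ d′ =
  map′ (λ (p , q , r , s) → mat≡ p q r s)
       (λ { refl → refl , refl , refl , refl })
       ((a ℤ.≟ a′) ×-dec (b ℤ.≟ b′) ×-dec (c ℤ.≟ c′) ×-dec (d ℤ.≟ d′))

⟪⟫-∙ : ∀ r M v → ⟪ r ∙ M ⟫ v ≡ ⟪ r ⟫ (M · v)
⟪⟫-∙ (a , b) (mat p q r s) (x , y) = lemma a b p q r s x y
  where
  lemma : ∀ a b p q r s x y →
    (a ℤ.* p ℤ.+ b ℤ.* r) ℤ.* x ℤ.+ (a ℤ.* q ℤ.+ b ℤ.* s) ℤ.* y ≡
    a ℤ.* (p ℤ.* x ℤ.+ q ℤ.* y) ℤ.+ b ℤ.* (r ℤ.* x ℤ.+ s ℤ.* y)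
  lemma = solve-∀

·-*ᴹ : ∀ M N v → (M *ᴹ N) · v ≡ M · (N · v)
·-*ᴹ M N v = cong₂ _,_ (⟪⟫-∙ (row₁ M) N v) (⟪⟫-∙ (row₂ M) N v)

⟪⟫-⊕ : ∀ r s v → ⟪ r ⊕ s ⟫ v ≡ ⟪ r ⟫ v ℤ.+ ⟪ s ⟫ v
⟪⟫-⊕ (a , b) (c , d) (x , y) = lemma a b c d x y
  where
  lemma : ∀ a b c d x y →
    (a ℤ.+ c) ℤ.* x ℤ.+ (b ℤ.+ d) ℤ.* y ≡
    a ℤ.* x ℤ.+ b ℤ.* y ℤ.+ (c ℤ.* x ℤ.+ d ℤ.* y)
  lemma = solve-∀

·-+ᴹ : ∀ M N v → (M +ᴹ N) · v ≡ M · v ⊕ N · v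
·-+ᴹ M@(mat _ _ _ _) N@(mat _ _ _ _) v =
  cong₂ _,_ (⟪⟫-⊕ (row₁ M) (row₁ N) v) (⟪⟫-⊕ (row₂ M) (row₂ N) v)

·-neg : ∀ M v → (-ᴹ M) · v ≡ (0ℤ , 0ℤ) ⊖ M · v
·-neg (mat a b c d) (x , y) = cong₂ _,_ (lemma a b x y) (lemma c d x y)
  where
  lemma : ∀ a b x y →
    ℤ.- a ℤ.* x ℤ.+ ℤ.- b ℤ.* y ≡ 0ℤ ℤ.- (a ℤ.* x ℤ.+ b ℤ.* y)
  lemma = solve-∀

0-· : ∀ v → 0ᴹ · v ≡ (0ℤ , 0ℤ)
0-· (x , y) = refl

------------------------------------------------------------------------
-- Linear inequalities on the cone 0 ≤ m ≤ n

vec : Proportions → Square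
vec (m , n) = ℤ.+ m , ℤ.+ n

-- The form is nonpositive at the generators (0 , 1) and (1 , 1) of the cone.
Nonpos : Form → Set
Nonpos (a , b) = (b ℤ.≤ 0ℤ) × (a ℤ.+ b ℤ.≤ 0ℤ)

nonpos? : ∀ r → Dec (Nonpos r)
nonpos? (a , b) = (b ℤ.≤? 0ℤ) ×-dec (a ℤ.+ b ℤ.≤? 0ℤ)

nonpos : ∀ {m n} r → m ≤ n → Nonpos r → ⟪ r ⟫ vec (m , n) ℤ.≤ 0ℤ
nonpos {m} {n} (a , b) m≤n (b≤0 , a+b≤0) = begin
  a ℤ.* ℤ.+ m ℤ.+ b ℤ.* ℤ.+ n
    ≡⟨ cong (λ k → a ℤ.* ℤ.+ m ℤ.+ b ℤ.* k) n≡ ⟩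
  a ℤ.* ℤ.+ m ℤ.+ b ℤ.* (ℤ.+ m ℤ.+ ℤ.+ (n ℕ.∸ m))
    ≡⟨ lemma a b (ℤ.+ m) (ℤ.+ (n ℕ.∸ m)) ⟩
  (a ℤ.+ b) ℤ.* ℤ.+ m ℤ.+ b ℤ.* ℤ.+ (n ℕ.∸ m)
    ≤⟨ ℤ.+-mono-≤ (ℤ.*-monoʳ-≤-nonNeg (ℤ.+ m) a+b≤0)
                  (ℤ.*-monoʳ-≤-nonNeg (ℤ.+ (n ℕ.∸ m)) b≤0) ⟩
  0ℤ ∎
  where
  open ℤ.≤-Reasoning
  n≡ : ℤ.+ n ≡ ℤ.+ m ℤ.+ ℤ.+ (n ℕ.∸ m)
  n≡ = trans (cong ℤ.+_ (sym (ℕ.m+[n∸m]≡n m≤n))) (ℤ.pos-+ m (n ℕ.∸ m))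
  lemma : ∀ a b m k → a ℤ.* m ℤ.+ b ℤ.* (m ℤ.+ k) ≡ (a ℤ.+ b) ℤ.* m ℤ.+ b ℤ.* k
  lemma = solve-∀

-- An interval of a coordinate is bounded by two forms in the proportions of a
-- frame, which as in Rectangle are compared with twice the coordinate.
Box : Set
Box = (Form × Form) × (Form × Form)

-- InBox B v s: the square s lies in the box B of the frame of proportions v.
InBox : Box → Square → Square → Set
InBox ((a , b) , (c , d)) v = Rectangle (⟪ a ⟫ v) (⟪ b ⟫ v) (⟪ c ⟫ v) (⟪ d ⟫ v)

infixl 7 _⋆_

-- The box expressed in the proportions v when its own are M · v.
_⋆_ : Box → Matrix → Box
((a , b) , (c , d)) ⋆ M = (a ∙ M , b ∙ M) , (c ∙ M , d ∙ M)

rectangle-cong : ∀ {a b c d a′ b′ c′ d′} → a ≡ a′ → b ≡ b′ → c ≡ c′ → d ≡ d′ →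
                 ∀ {s} → Rectangle a b c d s → Rectangle a′ b′ c′ d′ s
rectangle-cong refl refl refl refl p = p

pull : ∀ B M {v s} → InBox B (M · v) s → InBox (B ⋆ M) v s
pull ((a , b) , (c , d)) M {v} =
  rectangle-cong (sym (⟪⟫-∙ a M v)) (sym (⟪⟫-∙ b M v)) (sym (⟪⟫-∙ c M v)) (sym (⟪⟫-∙ d M v))

push : ∀ B M {v s} → InBox (B ⋆ M) v s → InBox B (M · v) s
push ((a , b) , (c , d)) M {v} =
  rectangle-cong (⟪⟫-∙ a M v) (⟪⟫-∙ b M v) (⟪⟫-∙ c M v) (⟪⟫-∙ d M v)

twice : Form → Form
twice r = r ⊕ r

-- Comparing bounds does not exclude, for all proportions in the cone at once,
-- that a coordinate moves by r from the first interval into the second one.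
-- Twice the displacement enters because the bounds concern twice the coordinate.
Possible₁ : Form × Form → Form → Form × Form → Set
Possible₁ (a , b) r (c , d) = ¬ Nonpos (d ⊖ a ⊖ twice r) × ¬ Nonpos (b ⊖ c ⊕ twice r)

-- The same for a square displaced by M times the proportions.
Possible : Box → Matrix → Box → Set
Possible (I , J) M (I′ , J′) = Possible₁ I (row₁ M) I′ × Possible₁ J (row₂ M) J′

-- For all proportions in the cone, the displacement r takes the whole first
-- interval into the second one.
Contained₁ : Form × Form → Form → Form × Form → Set
Contained₁ (a , b) r (c , d) = Nonpos (c ⊖ a ⊖ twice r) × Nonpos (b ⊖ d ⊕ twice r)

Contained : Box → Matrix → Box → Set
Contained (I , J) M (I′ , J′) = Contained₁ I (row₁ M) I′ × Contained₁ J (row₂ M) J′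

possible? : ∀ B M B′ → Dec (Possible B M B′)
possible? (I , J) M (I′ , J′) = possible₁? I (row₁ M) I′ ×-dec possible₁? J (row₂ M) J′
  where
  possible₁? : ∀ I r J → Dec (Possible₁ I r J)
  possible₁? (a , b) r (c , d) =
    ¬? (nonpos? (d ⊖ a ⊖ twice r)) ×-dec ¬? (nonpos? (b ⊖ c ⊕ twice r))

contained? : ∀ B M B′ → Dec (Contained B M B′)
contained? (I , J) M (I′ , J′) = contained₁? I (row₁ M) I′ ×-dec contained₁? J (row₂ M) J′
  where
  contained₁? : ∀ I r J → Dec (Contained₁ I r J)
  contained₁? (a , b) r (c , d) =
    nonpos? (c ⊖ a ⊖ twice r) ×-dec nonpos? (b ⊖ d ⊕ twice r)

⟪⟫-gap : ∀ a b r v → ⟪ a ⊖ b ⊖ twice r ⟫ v ≡ ⟪ a ⟫ v ℤ.- ⟪ b ⟫ v ℤ.- ℤ.+ 2 ℤ.* ⟪ r ⟫ v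
⟪⟫-gap (a , b) (c , d) (e , f′) (x , y) = lemma a b c d e f′ x y
  where
  lemma : ∀ a b c d e f x y →
    (a ℤ.- c ℤ.- (e ℤ.+ e)) ℤ.* x ℤ.+ (b ℤ.- d ℤ.- (f ℤ.+ f)) ℤ.* y ≡
    a ℤ.* x ℤ.+ b ℤ.* y ℤ.- (c ℤ.* x ℤ.+ d ℤ.* y) ℤ.- ℤ.+ 2 ℤ.* (e ℤ.* x ℤ.+ f ℤ.* y)
  lemma = solve-∀

⟪⟫-gap′ : ∀ a b r v → ⟪ a ⊖ b ⊕ twice r ⟫ v ≡ ⟪ a ⟫ v ℤ.- ⟪ b ⟫ v ℤ.+ ℤ.+ 2 ℤ.* ⟪ r ⟫ v
⟪⟫-gap′ (a , b) (c , d) (e , f′) (x , y) = lemma a b c d e f′ x y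
  where
  lemma : ∀ a b c d e f x y →
    (a ℤ.- c ℤ.+ (e ℤ.+ e)) ℤ.* x ℤ.+ (b ℤ.- d ℤ.+ (f ℤ.+ f)) ℤ.* y ≡
    a ℤ.* x ℤ.+ b ℤ.* y ℤ.- (c ℤ.* x ℤ.+ d ℤ.* y) ℤ.+ ℤ.+ 2 ℤ.* (e ℤ.* x ℤ.+ f ℤ.* y)
  lemma = solve-∀

0<- : ∀ {x y} → x ℤ.< y → 0ℤ ℤ.< y ℤ.- x
0<- {x} {y} x<y = subst (ℤ._< y ℤ.- x) (ℤ.+-inverseʳ x) (ℤ.+-monoˡ-< (ℤ.- x) x<y)

positive : ∀ {x y z} → z ≡ y ℤ.- x → x ℤ.< y → 0ℤ ℤ.< z
positive refl = 0<-

less : ∀ {x y z} → z ≡ y ℤ.- x → 0ℤ ℤ.< z → x ℤ.< y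
less {x} {y} refl 0<z = subst₂ ℤ._<_ (ℤ.+-identityʳ x) (lemma x y) (ℤ.+-monoʳ-< x 0<z)
  where
  lemma : ∀ x y → x ℤ.+ (y ℤ.- x) ≡ y
  lemma = solve-∀

possible₁ : ∀ {m n} → m ≤ n → ∀ a b r c d {x} → let v = vec (m , n) in
            ⟪ a ⟫ v ℤ.< ℤ.+ 2 ℤ.* x × ℤ.+ 2 ℤ.* x ℤ.< ⟪ b ⟫ v →
            ⟪ c ⟫ v ℤ.< ℤ.+ 2 ℤ.* (x ℤ.+ ⟪ r ⟫ v) × ℤ.+ 2 ℤ.* (x ℤ.+ ⟪ r ⟫ v) ℤ.< ⟪ d ⟫ v →
            Possible₁ (a , b) r (c , d)
possible₁ {m} {n} m≤n a b r c d {x} (a<x , x<b) (c<x′ , x′<d) =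
  (λ np → ℤ.<⇒≱
    (positive (trans (⟪⟫-gap d a r v) (lemma (⟪ d ⟫ v) (⟪ a ⟫ v) (⟪ r ⟫ v) x))
              (ℤ.+-mono-< a<x x′<d))
    (nonpos (d ⊖ a ⊖ twice r) m≤n np)) ,
  (λ np → ℤ.<⇒≱
    (positive (trans (⟪⟫-gap′ b c r v) (lemma′ (⟪ b ⟫ v) (⟪ c ⟫ v) (⟪ r ⟫ v) x))
              (ℤ.+-mono-< x<b c<x′))
    (nonpos (b ⊖ c ⊕ twice r) m≤n np))
  where
  v = vec (m , n)
  lemma : ∀ d a r x → d ℤ.- a ℤ.- ℤ.+ 2 ℤ.* r ≡
                      ℤ.+ 2 ℤ.* x ℤ.+ d ℤ.- (a ℤ.+ ℤ.+ 2 ℤ.* (x ℤ.+ r))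
  lemma = solve-∀
  lemma′ : ∀ b c r x → b ℤ.- c ℤ.+ ℤ.+ 2 ℤ.* r ≡
                       b ℤ.+ ℤ.+ 2 ℤ.* (x ℤ.+ r) ℤ.- (ℤ.+ 2 ℤ.* x ℤ.+ c)
  lemma′ = solve-∀

possible : ∀ {m n} → m ≤ n → ∀ B M B′ {s} → InBox B (vec (m , n)) s →
           InBox B′ (vec (m , n)) (s ⊕ M · vec (m , n)) → Possible B M B′
possible m≤n ((a , b) , (a′ , b′)) M@(mat _ _ _ _) ((c , d) , (c′ , d′)) (i , j) (i′ , j′) =
  possible₁ m≤n a b (row₁ M) c d i i′ , possible₁ m≤n a′ b′ (row₂ M) c′ d′ j j′

contained₁ : ∀ {m n} → m ≤ n → ∀ a b r c d {x} → let v = vec (m , n) in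
             Contained₁ (a , b) r (c , d) →
             ⟪ a ⟫ v ℤ.< ℤ.+ 2 ℤ.* x × ℤ.+ 2 ℤ.* x ℤ.< ⟪ b ⟫ v →
             ⟪ c ⟫ v ℤ.< ℤ.+ 2 ℤ.* (x ℤ.+ ⟪ r ⟫ v) × ℤ.+ 2 ℤ.* (x ℤ.+ ⟪ r ⟫ v) ℤ.< ⟪ d ⟫ v
contained₁ {m} {n} m≤n a b r c d {x} (lower , upper) (a<x , x<b) =
  less (lemma (⟪ c ⟫ v) (⟪ a ⟫ v) (⟪ r ⟫ v) x)
    (0<- (ℤ.≤-<-trans
      (subst (ℤ._≤ 0ℤ) (⟪⟫-gap c a r v) (nonpos (c ⊖ a ⊖ twice r) m≤n lower)) (0<- a<x))) ,
  less (lemma′ (⟪ b ⟫ v) (⟪ d ⟫ v) (⟪ r ⟫ v) x)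
    (0<- (ℤ.≤-<-trans
      (subst (ℤ._≤ 0ℤ) (⟪⟫-gap′ b d r v) (nonpos (b ⊖ d ⊕ twice r) m≤n upper)) (0<- x<b)))
  where
  v = vec (m , n)
  lemma : ∀ c a r x → (ℤ.+ 2 ℤ.* x ℤ.- a) ℤ.- (c ℤ.- a ℤ.- ℤ.+ 2 ℤ.* r) ≡
                      ℤ.+ 2 ℤ.* (x ℤ.+ r) ℤ.- c
  lemma = solve-∀
  lemma′ : ∀ b d r x → (b ℤ.- ℤ.+ 2 ℤ.* x) ℤ.- (b ℤ.- d ℤ.+ ℤ.+ 2 ℤ.* r) ≡
                       d ℤ.- ℤ.+ 2 ℤ.* (x ℤ.+ r)
  lemma′ = solve-∀

contained : ∀ {m n} → m ≤ n → ∀ B M B′ {s} → Contained B M B′ → InBox B (vec (m , n)) s →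
            InBox B′ (vec (m , n)) (s ⊕ M · vec (m , n))
contained m≤n ((a , b) , (a′ , b′)) M@(mat _ _ _ _) ((c , d) , (c′ , d′)) (p , q) (i , j) =
  contained₁ m≤n a b (row₁ M) c d p i , contained₁ m≤n a′ b′ (row₂ M) c′ d′ q j

------------------------------------------------------------------------
-- Sections as boxes

-- A section of a frame is a product of two of the intervals low, mid and high,
-- and the hole is the remaining product.
lowᴵ midᴵ highᴵ boardᴵ : Form × Form
lowᴵ   = (-1ℤ , -1ℤ) , (1ℤ , -1ℤ)
midᴵ   = (1ℤ , -1ℤ) , (-1ℤ , 1ℤ)
highᴵ  = (-1ℤ , 1ℤ) , (1ℤ , 1ℤ)
boardᴵ = (-1ℤ , -1ℤ) , (1ℤ , 1ℤ)

hole board : Box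
hole  = midᴵ , midᴵ
board = boardᴵ , boardᴵ

-- The counterclockwise rotation by 90°.
turn : Box → Box
turn (I , (c , d)) = ((0ℤ , 0ℤ) ⊖ d , (0ℤ , 0ℤ) ⊖ c) , I

baseBox : Kind → Box
baseBox edge   = highᴵ , midᴵ
baseBox corner = highᴵ , highᴵ

-- The section in a given direction.
box : Compass → Box
box (κ , k) = fold (baseBox κ) turn (toℕ k)

neg-< : ∀ r v x → ⟪ r ⟫ v ℤ.< ℤ.+ 2 ℤ.* ℤ.- x → ℤ.+ 2 ℤ.* x ℤ.< ⟪ (0ℤ , 0ℤ) ⊖ r ⟫ v
neg-< r@(a , b) v@(x , y) z p = less (lemma (a) b x y z) (0<- p)
  where
  lemma : ∀ a b x y z → ℤ.+ 2 ℤ.* ℤ.- z ℤ.- (a ℤ.* x ℤ.+ b ℤ.* y) ≡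
          ((0ℤ ℤ.- a) ℤ.* x ℤ.+ (0ℤ ℤ.- b) ℤ.* y) ℤ.- ℤ.+ 2 ℤ.* z
  lemma = solve-∀

neg-> : ∀ r v x → ℤ.+ 2 ℤ.* ℤ.- x ℤ.< ⟪ r ⟫ v → ⟪ (0ℤ , 0ℤ) ⊖ r ⟫ v ℤ.< ℤ.+ 2 ℤ.* x
neg-> r@(a , b) v@(x , y) z p = less (lemma (a) b x y z) (0<- p)
  where
  lemma : ∀ a b x y z → (a ℤ.* x ℤ.+ b ℤ.* y) ℤ.- ℤ.+ 2 ℤ.* ℤ.- z ≡
          ℤ.+ 2 ℤ.* z ℤ.- ((0ℤ ℤ.- a) ℤ.* x ℤ.+ (0ℤ ℤ.- b) ℤ.* y)
  lemma = solve-∀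

neg-<⁻¹ : ∀ r v x → ℤ.+ 2 ℤ.* x ℤ.< ⟪ (0ℤ , 0ℤ) ⊖ r ⟫ v → ⟪ r ⟫ v ℤ.< ℤ.+ 2 ℤ.* ℤ.- x
neg-<⁻¹ r@(a , b) v@(x , y) z p = less (lemma (a) b x y z) (0<- p)
  where
  lemma : ∀ a b x y z → ((0ℤ ℤ.- a) ℤ.* x ℤ.+ (0ℤ ℤ.- b) ℤ.* y) ℤ.- ℤ.+ 2 ℤ.* z ≡
          ℤ.+ 2 ℤ.* ℤ.- z ℤ.- (a ℤ.* x ℤ.+ b ℤ.* y)
  lemma = solve-∀

neg->⁻¹ : ∀ r v x → ⟪ (0ℤ , 0ℤ) ⊖ r ⟫ v ℤ.< ℤ.+ 2 ℤ.* x → ℤ.+ 2 ℤ.* ℤ.- x ℤ.< ⟪ r ⟫ v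
neg->⁻¹ r@(a , b) v@(x , y) z p = less (lemma (a) b x y z) (0<- p)
  where
  lemma : ∀ a b x y z → ℤ.+ 2 ℤ.* z ℤ.- ((0ℤ ℤ.- a) ℤ.* x ℤ.+ (0ℤ ℤ.- b) ℤ.* y) ≡
          (a ℤ.* x ℤ.+ b ℤ.* y) ℤ.- ℤ.+ 2 ℤ.* ℤ.- z
  lemma = solve-∀

cw⇒turn : ∀ B {v s} → InBox B v (cw s) → InBox (turn B) v s
cw⇒turn (_ , (c , d)) {v} {x , _} (i , (l , u)) = (neg-> d v x u , neg-< c v x l) , i

turn⇒cw : ∀ B {v s} → InBox (turn B) v s → InBox B v (cw s)
turn⇒cw (_ , (c , d)) {v} {x , _} ((l , u) , i) = i , (neg-<⁻¹ c v x u , neg->⁻¹ d v x l)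

unrotate⇒turn : ∀ B n {v s} → InBox B v (iterate cw s n) → InBox (fold B turn n) v s
unrotate⇒turn B zero    p = p
unrotate⇒turn B (suc n) p = cw⇒turn (fold B turn n) (unrotate⇒turn B n p)

turn⇒unrotate : ∀ B n {v s} → InBox (fold B turn n) v s → InBox B v (iterate cw s n)
turn⇒unrotate B zero    p = p
turn⇒unrotate B (suc n) p = turn⇒unrotate B n (turn⇒cw (fold B turn n) p)

high-lower : ∀ m n → n ℤ.⊖ m ≡ ⟪ -1ℤ , 1ℤ ⟫ vec (m , n)
high-lower m n = trans (sym (ℤ.m-n≡m⊖n n m)) (lemma (ℤ.+ m) (ℤ.+ n))
  where
  lemma : ∀ m n → n ℤ.- m ≡ -1ℤ ℤ.* m ℤ.+ 1ℤ ℤ.* n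
  lemma = solve-∀

mid-lower : ∀ m n → m ℤ.⊖ n ≡ ⟪ 1ℤ , -1ℤ ⟫ vec (m , n)
mid-lower m n = trans (sym (ℤ.m-n≡m⊖n m n)) (lemma (ℤ.+ m) (ℤ.+ n))
  where
  lemma : ∀ m n → m ℤ.- n ≡ 1ℤ ℤ.* m ℤ.+ -1ℤ ℤ.* n
  lemma = solve-∀

high-upper : ∀ m n → ℤ.+ (m ℕ.+ n) ≡ ⟪ 1ℤ , 1ℤ ⟫ vec (m , n)
high-upper m n = lemma (ℤ.+ m) (ℤ.+ n)
  where
  lemma : ∀ m n → m ℤ.+ n ≡ 1ℤ ℤ.* m ℤ.+ 1ℤ ℤ.* n
  lemma = solve-∀

board-lower : ∀ m n → ℤ.- ℤ.+ (m ℕ.+ n) ≡ ⟪ -1ℤ , -1ℤ ⟫ vec (m , n)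
board-lower m n = lemma (ℤ.+ m) (ℤ.+ n)
  where
  lemma : ∀ m n → ℤ.- (m ℤ.+ n) ≡ -1ℤ ℤ.* m ℤ.+ -1ℤ ℤ.* n
  lemma = solve-∀

board⇒box : ∀ {m n} {s} → s ∈ Board (m ℕ.+ n) → InBox board (vec (m , n)) s
board⇒box {m} {n} =
  rectangle-cong (board-lower m n) (high-upper m n) (board-lower m n) (high-upper m n)

section⇒box : ∀ F c {s} → s ∈ section F c → InBox (box c) (vec F) s
section⇒box (m , n) (edge , k) p = unrotate⇒turn (baseBox edge) (toℕ k)
  (rectangle-cong (high-lower m n) (high-upper m n) (mid-lower m n) (high-lower m n) p)
section⇒box (m , n) (corner , k) p = unrotate⇒turn (baseBox corner) (toℕ k)
  (rectangle-cong (high-lower m n) (high-upper m n) (high-lower m n) (high-upper m n) p)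

box⇒section : ∀ F c {s} → InBox (box c) (vec F) s → s ∈ section F c
box⇒section (m , n) (edge , k) p =
  rectangle-cong (sym (high-lower m n)) (sym (high-upper m n))
                 (sym (mid-lower m n)) (sym (high-lower m n))
    (turn⇒unrotate (baseBox edge) (toℕ k) p)
box⇒section (m , n) (corner , k) p =
  rectangle-cong (sym (high-lower m n)) (sym (high-upper m n))
                 (sym (high-lower m n)) (sym (high-upper m n))
    (turn⇒unrotate (baseBox corner) (toℕ k) p)

------------------------------------------------------------------------
-- Liftings as matrices

-- U t takes the proportions of a frame to those of the lifted frame, and T t is
-- its inverse.
U T : Lifting → Matrix
U f = mat 1ℤ 0ℤ +2 1ℤ
U g = mat 0ℤ 1ℤ -1ℤ +2
U h = mat 0ℤ 1ℤ 1ℤ +2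
T f = mat 1ℤ 0ℤ (ℤ.- +2) 1ℤ
T g = mat +2 -1ℤ 1ℤ 0ℤ
T h = mat (ℤ.- +2) 1ℤ 1ℤ 0ℤ

ccwᴹ : Matrix → Matrix
ccwᴹ (mat a b c d) = mat (ℤ.- c) (ℤ.- d) a b

baseV : Kind → Matrix
baseV edge   = mat -1ℤ 1ℤ 0ℤ 0ℤ
baseV corner = mat 1ℤ 0ℤ 1ℤ 0ℤ

-- The shift into the section c of a lifted frame of proportions (p , q) is
-- V c · (p , q), for all three types of lifting.
V : Compass → Matrix
V (κ , k) = iterate ccwᴹ (baseV κ) (toℕ k)

ccw-· : ∀ M v → ccw (M · v) ≡ ccwᴹ M · v
ccw-· (mat a b c d) (x , y) = cong (_, _) (lemma c d x y)
  where
  lemma : ∀ c d x y → ℤ.- (c ℤ.* x ℤ.+ d ℤ.* y) ≡ ℤ.- c ℤ.* x ℤ.+ ℤ.- d ℤ.* y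
  lemma = solve-∀

rotate-· : ∀ n M v → iterate ccw (M · v) n ≡ iterate ccwᴹ M n · v
rotate-· zero    M v = refl
rotate-· (suc n) M v = trans (cong (λ s → iterate ccw s n) (ccw-· M v)) (rotate-· n (ccwᴹ M) v)

lift-vec : ∀ t {m n} → m ≤ n → vec (liftFrame t (m , n)) ≡ U t · vec (m , n)
lift-vec f {m} {n} _ = cong₂ _,_ (lemma₁ (ℤ.+ m) (ℤ.+ n))
  (trans (ℤ.pos-+ (2 ℕ.* m) n) (trans (cong (ℤ._+ ℤ.+ n) (ℤ.pos-* 2 m)) (lemma₂ (ℤ.+ m) (ℤ.+ n))))
  where
  lemma₁ : ∀ m n → m ≡ 1ℤ ℤ.* m ℤ.+ 0ℤ ℤ.* n
  lemma₁ = solve-∀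
  lemma₂ : ∀ m n → ℤ.+ 2 ℤ.* m ℤ.+ n ≡ +2 ℤ.* m ℤ.+ 1ℤ ℤ.* n
  lemma₂ = solve-∀
lift-vec g {m} {n} m≤n = cong₂ _,_ (lemma₁ (ℤ.+ m) (ℤ.+ n))
  (trans (sym (ℤ.⊖-≥ (ℕ.≤-trans m≤n (ℕ.m≤m+n n (n ℕ.+ 0)))))
    (trans (sym (ℤ.m-n≡m⊖n (2 ℕ.* n) m))
      (trans (cong (ℤ._- ℤ.+ m) (ℤ.pos-* 2 n)) (lemma₂ (ℤ.+ m) (ℤ.+ n)))))
  where
  lemma₁ : ∀ m n → n ≡ 0ℤ ℤ.* m ℤ.+ 1ℤ ℤ.* n
  lemma₁ = solve-∀
  lemma₂ : ∀ m n → ℤ.+ 2 ℤ.* n ℤ.- m ≡ -1ℤ ℤ.* m ℤ.+ +2 ℤ.* n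
  lemma₂ = solve-∀
lift-vec h {m} {n} _ = cong₂ _,_ (lemma₁ (ℤ.+ m) (ℤ.+ n))
  (trans (ℤ.pos-+ m (2 ℕ.* n))
    (trans (cong (λ k → ℤ.+ m ℤ.+ k) (ℤ.pos-* 2 n)) (lemma₂ (ℤ.+ m) (ℤ.+ n))))
  where
  lemma₁ : ∀ m n → n ≡ 0ℤ ℤ.* m ℤ.+ 1ℤ ℤ.* n
  lemma₁ = solve-∀
  lemma₂ : ∀ m n → m ℤ.+ ℤ.+ 2 ℤ.* n ≡ 1ℤ ℤ.* m ℤ.+ +2 ℤ.* n
  lemma₂ = solve-∀

1-· : ∀ v → 1ᴹ · v ≡ v
1-· (x , y) = cong₂ _,_ (lemma x y) (lemma′ x y)
  where
  lemma : ∀ x y → 1ℤ ℤ.* x ℤ.+ 0ℤ ℤ.* y ≡ x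
  lemma = solve-∀
  lemma′ : ∀ x y → 0ℤ ℤ.* x ℤ.+ 1ℤ ℤ.* y ≡ y
  lemma′ = solve-∀

T-U : ∀ t → T t *ᴹ U t ≡ 1ᴹ
T-U f = refl
T-U g = refl
T-U h = refl

unlift-vec : ∀ t {m n} → m ≤ n → T t · vec (liftFrame t (m , n)) ≡ vec (m , n)
unlift-vec t {m} {n} m≤n = begin
  T t · vec (liftFrame t (m , n)) ≡⟨ cong (T t ·_) (lift-vec t m≤n) ⟩
  T t · (U t · vec (m , n))       ≡⟨ ·-*ᴹ (T t) (U t) _ ⟨
  (T t *ᴹ U t) · vec (m , n)      ≡⟨ cong (_· vec (m , n)) (T-U t) ⟩
  1ᴹ · vec (m , n)                ≡⟨ 1-· _ ⟩
  vec (m , n)                     ∎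
  where open ≡-Reasoning

baseShift-V : ∀ t {m n} → m ≤ n → ∀ κ →
              baseShift t (m , n) κ ≡ (baseV κ *ᴹ U t) · vec (m , n)
baseShift-V t {m} {n} m≤n κ = go t κ
  where
  x = ℤ.+ m
  y = ℤ.+ n
  sum : ∀ x y → x ℤ.+ y ≡ 1ℤ ℤ.* x ℤ.+ 1ℤ ℤ.* y
  sum = solve-∀
  difference : ∀ x y → y ℤ.- x ≡ -1ℤ ℤ.* x ℤ.+ 1ℤ ℤ.* y
  difference = solve-∀
  first : ∀ x y → x ≡ 1ℤ ℤ.* x ℤ.+ 0ℤ ℤ.* y
  first = solve-∀
  second : ∀ x y → y ≡ 0ℤ ℤ.* x ℤ.+ 1ℤ ℤ.* y
  second = solve-∀
  go : ∀ t κ → baseShift t (m , n) κ ≡ (baseV κ *ᴹ U t) · vec (m , n)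
  go f edge   = cong (_, 0ℤ) (sum x y)
  go f corner = cong₂ _,_ (first x y) (first x y)
  go g edge   = cong (_, 0ℤ) (trans (sym (ℤ.m-n≡m⊖n n m)) (difference x y))
  go g corner = cong₂ _,_ (second x y) (second x y)
  go h edge   = cong (_, 0ℤ) (sum x y)
  go h corner = cong₂ _,_ (second x y) (second x y)

shift-V : ∀ t {m n} → m ≤ n → ∀ c → shift t (m , n) c ≡ V c · vec (liftFrame t (m , n))
shift-V t {m} {n} m≤n (κ , k) = begin
  rotate k (baseShift t (m , n) κ)
    ≡⟨ cong (rotate k) (baseShift-V t m≤n κ) ⟩
  rotate k ((baseV κ *ᴹ U t) · vec (m , n))
    ≡⟨ cong (rotate k) (·-*ᴹ (baseV κ) (U t) _) ⟩
  rotate k (baseV κ · (U t · vec (m , n)))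
    ≡⟨ cong (λ v → rotate k (baseV κ · v)) (lift-vec t m≤n) ⟨
  rotate k (baseV κ · vec (liftFrame t (m , n)))
    ≡⟨ rotate-· (toℕ k) (baseV κ) _ ⟩
  V (κ , k) · vec (liftFrame t (m , n)) ∎
  where open ≡-Reasoning

------------------------------------------------------------------------
-- Finite checks on moves and sections

allCompass? : ∀ {P : Compass → Set} → (∀ c → Dec (P c)) → Dec (∀ c → P c)
allCompass? P? =
  map′ (λ { (p , q) (edge , k) → p k ; (p , q) (corner , k) → q k })
       (λ p → (λ k → p (edge , k)) , (λ k → p (corner , k)))
       (all? (λ k → P? (edge , k)) ×-dec all? (λ k → P? (corner , k)))

allLifting? : ∀ {P : Lifting → Set} → (∀ t → Dec (P t)) → Dec (∀ t → P t)
allLifting? P? =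
  map′ (λ { (p , q , r) f → p ; (p , q , r) g → q ; (p , q , r) h → r })
       (λ p → p f , p g , p h)
       (P? f ×-dec P? g ×-dec P? h)

_≟ᶜ_ : (c c′ : Compass) → Dec (c ≡ c′)
_≟ᶜ_ = ≡-dec _≟ᴷ_ Fin._≟_
  where
  _≟ᴷ_ : (κ κ′ : Kind) → Dec (κ ≡ κ′)
  edge   ≟ᴷ edge   = yes refl
  edge   ≟ᴷ corner = no λ ()
  corner ≟ᴷ edge   = no λ ()
  corner ≟ᴷ corner = yes refl

-- M · v, where v are the proportions of a frame lifted by t, is zero or a move of
-- the leaper before the lifting.
Descends : Lifting → Matrix → Set
Descends t M = M ≡ 0ᴹ ⊎ ∃[ d ] M ≡ A d *ᴹ T t

-- Sealed, so that the computed proofs are not unfolded later on.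
abstract
  -- Let two lifted squares in the sections i and j be joined by a move of
  -- direction d.  The squares that they are lifted from differ by
  -- A d + V i - V j, in the new proportions.
  moves-descend : ∀ t d i j → Possible (box i ⋆ U t) (A d *ᴹ U t) (box j ⋆ U t) →
                  Descends t (A d +ᴹ V i +ᴹ (-ᴹ V j))
  moves-descend = toWitness {a? =
    allLifting? λ t → all? λ d → allCompass? λ i → allCompass? λ j →
    possible? (box i ⋆ U t) (A d *ᴹ U t) (box j ⋆ U t) →-dec
    (((A d +ᴹ V i +ᴹ (-ᴹ V j)) ≟ᴹ 0ᴹ) ⊎-dec
     any? λ d′ → (A d +ᴹ V i +ᴹ (-ᴹ V j)) ≟ᴹ (A d′ *ᴹ T t))} _

  hole-no-exit : ∀ d → ¬ Possible hole (A d) board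
  hole-no-exit = toWitness {a? = all? λ d → ¬? (possible? hole (A d) board)} _

  hole-no-entry : ∀ d → ¬ Possible board (A d) hole
  hole-no-entry = toWitness {a? = all? λ d → ¬? (possible? board (A d) hole)} _

  -- A square of a section has at most two moves within the board.
  two-moves : ∀ i → ∃[ d₁ ] ∃[ d₂ ] ∀ d → Possible (box i) (A d) board → d ≡ d₁ ⊎ d ≡ d₂
  two-moves = toWitness {a? = allCompass? λ i → any? λ d₁ → any? λ d₂ → all? λ d →
    possible? (box i) (A d) board →-dec ((d Fin.≟ d₁) ⊎-dec (d Fin.≟ d₂))} _

  sections-disjoint : ∀ i j → Possible (box i) 0ᴹ (box j) → i ≡ j
  sections-disjoint = toWitness {a? = allCompass? λ i → allCompass? λ j →
    possible? (box i) 0ᴹ (box j) →-dec (i ≟ᶜ j)} _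

  hole-disjoint : ∀ i → ¬ Possible hole 0ᴹ (box i)
  hole-disjoint = toWitness {a? = allCompass? λ i → ¬? (possible? hole 0ᴹ (box i))} _

  hole⊆board : Contained hole 0ᴹ board
  hole⊆board = toWitness {a? = contained? hole 0ᴹ board} _

  section⊆board : ∀ i → Contained (box i) 0ᴹ board
  section⊆board = toWitness {a? = allCompass? λ i → contained? (box i) 0ᴹ board} _

  -- A square of a section is a lift of a square of the smaller board.
  section-from-board : ∀ t i → Contained (box i ⋆ U t) ((-ᴹ V i) *ᴹ U t) board
  section-from-board = toWitness {a? = allLifting? λ t → allCompass? λ i →
    contained? (box i ⋆ U t) ((-ᴹ V i) *ᴹ U t) board} _

⊕-identity : ∀ s → s ⊕ (0ℤ , 0ℤ) ≡ s
⊕-identity (x , y) = cong₂ _,_ (ℤ.+-identityʳ x) (ℤ.+-identityʳ y)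

possible₀ : ∀ {m n} → m ≤ n → ∀ B B′ {s} → InBox B (vec (m , n)) s → InBox B′ (vec (m , n)) s →
            Possible B 0ᴹ B′
possible₀ m≤n B B′ {s} p q =
  possible m≤n B 0ᴹ B′ p (subst (InBox B′ _) (sym (⊕-identity s)) q)

widen : ∀ {m n} → m ≤ n → ∀ B B′ {s} → Contained B 0ᴹ B′ → InBox B (vec (m , n)) s →
        InBox B′ (vec (m , n)) s
widen m≤n B B′ {s} c p = subst (InBox B′ _) (⊕-identity s) (contained m≤n B 0ᴹ B′ c p)

------------------------------------------------------------------------
-- Frames obtained from the (0 , 1)-frame

-- The hole of the (0 , 1)-frame is a single square, which is the whole board.
frame : List Lifting → Proportions
frame w = liftFrames w (0 , 1)

liftFrame-≤ : ∀ t {m n} → m ≤ n → proj₁ (liftFrame t (m , n)) ≤ proj₂ (liftFrame t (m , n))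
liftFrame-≤ f {m} {n} _ = ℕ.≤-trans (ℕ.m≤m+n m (m ℕ.+ 0)) (ℕ.m≤m+n (2 ℕ.* m) n)
liftFrame-≤ g {m} {n} m≤n =
  subst (n ≤_) (sym (ℕ.+-∸-assoc n {n ℕ.+ 0} (ℕ.≤-trans m≤n (ℕ.m≤m+n n 0)))) (ℕ.m≤m+n n _)
liftFrame-≤ h {m} {n} _ = ℕ.≤-trans (ℕ.m≤m+n n (n ℕ.+ 0)) (ℕ.m≤n+m (2 ℕ.* n) m)

frame-≤ : ∀ w → proj₁ (frame w) ≤ proj₂ (frame w)
frame-≤ []      = z≤n
frame-≤ (t ∷ w) = liftFrame-≤ t (frame-≤ w)

-- The side n - m of the hole is odd.
frame-odd : ∀ w → ∃[ k ] ⟪ -1ℤ , 1ℤ ⟫ vec (frame w) ≡ 1ℤ ℤ.+ +2 ℤ.* k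
frame-odd []      = 0ℤ , refl
frame-odd (t ∷ w) = go t (frame-odd w)
  where
  m = proj₁ (frame w)
  n = proj₂ (frame w)
  raise : ∀ a b c d → ⟪ -1ℤ , 1ℤ ⟫ (mat a b c d · vec (m , n)) ≡
                      (c ℤ.- a) ℤ.* ℤ.+ m ℤ.+ (d ℤ.- b) ℤ.* ℤ.+ n
  raise a b c d = lemma a b c d (ℤ.+ m) (ℤ.+ n)
    where
    lemma : ∀ a b c d m n → -1ℤ ℤ.* (a ℤ.* m ℤ.+ b ℤ.* n) ℤ.+ 1ℤ ℤ.* (c ℤ.* m ℤ.+ d ℤ.* n) ≡
                            (c ℤ.- a) ℤ.* m ℤ.+ (d ℤ.- b) ℤ.* n
    lemma = solve-∀
  more : ∀ k m n → -1ℤ ℤ.* m ℤ.+ 1ℤ ℤ.* n ≡ 1ℤ ℤ.+ +2 ℤ.* k →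
         1ℤ ℤ.* m ℤ.+ 1ℤ ℤ.* n ≡ 1ℤ ℤ.+ +2 ℤ.* (k ℤ.+ m)
  more k m n eq = trans (lemma m n) (trans (cong (ℤ._+ +2 ℤ.* m) eq) (lemma′ k m))
    where
    lemma : ∀ m n → 1ℤ ℤ.* m ℤ.+ 1ℤ ℤ.* n ≡ -1ℤ ℤ.* m ℤ.+ 1ℤ ℤ.* n ℤ.+ +2 ℤ.* m
    lemma = solve-∀
    lemma′ : ∀ k m → 1ℤ ℤ.+ +2 ℤ.* k ℤ.+ +2 ℤ.* m ≡ 1ℤ ℤ.+ +2 ℤ.* (k ℤ.+ m)
    lemma′ = solve-∀
  go : ∀ t → ∃[ k ] ⟪ -1ℤ , 1ℤ ⟫ vec (frame w) ≡ 1ℤ ℤ.+ +2 ℤ.* k →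
       ∃[ k ] ⟪ -1ℤ , 1ℤ ⟫ vec (frame (t ∷ w)) ≡ 1ℤ ℤ.+ +2 ℤ.* k
  go f (k , eq) = k ℤ.+ ℤ.+ m ,
    trans (cong ⟪ -1ℤ , 1ℤ ⟫_ (lift-vec f (frame-≤ w)))
      (trans (raise 1ℤ 0ℤ +2 1ℤ) (more k (ℤ.+ m) (ℤ.+ n) eq))
  go g (k , eq) = k ,
    trans (cong ⟪ -1ℤ , 1ℤ ⟫_ (lift-vec g (frame-≤ w))) (trans (raise 0ℤ 1ℤ -1ℤ +2) eq)
  go h (k , eq) = k ℤ.+ ℤ.+ m ,
    trans (cong ⟪ -1ℤ , 1ℤ ⟫_ (lift-vec h (frame-≤ w)))
      (trans (raise 0ℤ 1ℤ 1ℤ +2) (more k (ℤ.+ m) (ℤ.+ n) eq))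

even≢odd : ∀ x k → +2 ℤ.* x ≢ 1ℤ ℤ.+ +2 ℤ.* k
even≢odd x k eq = ℕ.even≢odd ℤ.∣ x ℤ.- k ∣ 0 (trans (sym (ℤ.abs-* +2 (x ℤ.- k))) (cong ℤ.∣_∣ 2*≡1))
  where
  lemma : ∀ x k → +2 ℤ.* (x ℤ.- k) ≡ +2 ℤ.* x ℤ.- +2 ℤ.* k
  lemma = solve-∀
  lemma′ : ∀ k → 1ℤ ℤ.+ +2 ℤ.* k ℤ.- +2 ℤ.* k ≡ 1ℤ
  lemma′ = solve-∀
  2*≡1 : +2 ℤ.* (x ℤ.- k) ≡ 1ℤ
  2*≡1 = trans (lemma x k) (trans (cong (ℤ._- +2 ℤ.* k) eq) (lemma′ k))

Inside : Form × Form → Square → ℤ → Set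
Inside (a , b) v x = ⟪ a ⟫ v ℤ.< ℤ.+ 2 ℤ.* x × ℤ.+ 2 ℤ.* x ℤ.< ⟪ b ⟫ v

-- Low, mid and high exhaust the board: the bounds between them are odd, so twice
-- a coordinate never equals them.
zone : ∀ w x → let v = vec (frame w) in Inside boardᴵ v x →
       Inside lowᴵ v x ⊎ Inside midᴵ v x ⊎ Inside highᴵ v x
zone w x (l , u) with frame-odd w
                      | ℤ.<-cmp (ℤ.+ 2 ℤ.* x) (⟪ 1ℤ , -1ℤ ⟫ vec (frame w))
                      | ℤ.<-cmp (ℤ.+ 2 ℤ.* x) (⟪ -1ℤ , 1ℤ ⟫ vec (frame w))
... | _      | tri< x<a _ _ | _            = inj₁ (l , x<a)
... | _      | tri> _ _ a<x | tri< x<b _ _ = inj₂ (inj₁ (a<x , x<b))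
... | _      | tri> _ _ _   | tri> _ _ b<x = inj₂ (inj₂ (b<x , u))
... | k , eq | _            | tri≈ _ x≡b _ = contradiction (trans x≡b eq) (even≢odd x k)
... | k , eq | tri≈ _ x≡a _ | _            =
  contradiction (trans x≡a (trans (lemma m n) (trans (cong ℤ.-_ eq) (lemma′ k))))
                (even≢odd x (-1ℤ ℤ.- k))
  where
  m = ℤ.+ proj₁ (frame w)
  n = ℤ.+ proj₂ (frame w)
  lemma : ∀ m n → 1ℤ ℤ.* m ℤ.+ -1ℤ ℤ.* n ≡ ℤ.- (-1ℤ ℤ.* m ℤ.+ 1ℤ ℤ.* n)
  lemma = solve-∀
  lemma′ : ∀ k → ℤ.- (1ℤ ℤ.+ +2 ℤ.* k) ≡ 1ℤ ℤ.+ +2 ℤ.* (-1ℤ ℤ.- k)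
  lemma′ = solve-∀

locate : ∀ w s → InBox board (vec (frame w)) s →
         InBox hole (vec (frame w)) s ⊎ ∃[ c ] InBox (box c) (vec (frame w)) s
locate w (x , y) (p , q) with zone w x p | zone w y q
... | inj₁ i        | inj₁ j        = inj₂ ((corner , 2F) , i , j)
... | inj₁ i        | inj₂ (inj₁ j) = inj₂ ((edge   , 2F) , i , j)
... | inj₁ i        | inj₂ (inj₂ j) = inj₂ ((corner , 1F) , i , j)
... | inj₂ (inj₁ i) | inj₁ j        = inj₂ ((edge   , 3F) , i , j)
... | inj₂ (inj₁ i) | inj₂ (inj₁ j) = inj₁ (i , j)
... | inj₂ (inj₁ i) | inj₂ (inj₂ j) = inj₂ ((edge   , 1F) , i , j)
... | inj₂ (inj₂ i) | inj₁ j        = inj₂ ((corner , 3F) , i , j)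
... | inj₂ (inj₂ i) | inj₂ (inj₁ j) = inj₂ ((edge   , 0F) , i , j)
... | inj₂ (inj₂ i) | inj₂ (inj₂ j) = inj₂ ((corner , 0F) , i , j)

------------------------------------------------------------------------
-- Coordinates of squares

-- Coordinates w s X: the square s of the board around the frame w receives the
-- matrix X.  The squares of the hole receive zero, an arbitrary choice as no
-- move starts or ends there, and a lift of a square receives the matrix of that
-- square, rewritten in the new proportions, plus that of the shift.
data Coordinates : List Lifting → Square → Matrix → Set where
  origin : ∀ {w s} → InBox hole (vec (frame w)) s → Coordinates w s 0ᴹ
  lifted : ∀ {t w s s′ X} c → let v = vec (frame (t ∷ w)) in
           InBox (box c) v s′ → s′ ≡ s ⊕ V c · v → Coordinates w s X →
           Coordinates (t ∷ w) s′ (X *ᴹ T t +ᴹ V c)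

coordinates⇒board : ∀ w {s X} → Coordinates w s X → InBox board (vec (frame w)) s
coordinates⇒board w (origin p)           = widen (frame-≤ w) hole board hole⊆board p
coordinates⇒board w (lifted c p _ _) = widen (frame-≤ w) (box c) board (section⊆board c) p

⊕-cancelʳ : ∀ s s′ v → s ⊕ v ≡ s′ ⊕ v → s ≡ s′
⊕-cancelʳ (a , b) (c , d) (x , y) eq =
  cong₂ _,_ (∙-cancelʳ ℤ.+-0-abelianGroup x a c (cong proj₁ eq))
            (∙-cancelʳ ℤ.+-0-abelianGroup y b d (cong proj₂ eq))

coordinates-unique : ∀ w {s X Y} → Coordinates w s X → Coordinates w s Y → X ≡ Y
coordinates-unique w (origin _) (origin _) = refl
coordinates-unique w (origin p) (lifted c q _ _) =
  contradiction (possible₀ (frame-≤ w) hole (box c) p q) (hole-disjoint c)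
coordinates-unique w (lifted c q _ _) (origin p) =
  contradiction (possible₀ (frame-≤ w) hole (box c) p q) (hole-disjoint c)
coordinates-unique (t ∷ w) (lifted {s = s} i p eq x) (lifted {s = s′} j q eq′ y) =
  cong₂ (λ X i → X *ᴹ T t +ᴹ V i)
    (coordinates-unique w x (subst (λ s → Coordinates w s _) (sym s≡s′) y)) i≡j
  where
  i≡j : i ≡ j
  i≡j = sections-disjoint i j (possible₀ (frame-≤ (t ∷ w)) (box i) (box j) p q)
  s≡s′ : s ≡ s′
  s≡s′ = ⊕-cancelʳ s s′ _
    (trans (sym eq) (trans eq′ (cong (λ j → s′ ⊕ V j · vec (frame (t ∷ w))) (sym i≡j))))

⊖⇒⊕ : ∀ a b v → b ⊖ a ≡ v → b ≡ a ⊕ v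
⊖⇒⊕ (x , y) (x′ , y′) v refl = cong₂ _,_ (lemma x x′) (lemma y y′)
  where
  lemma : ∀ x y → y ≡ x ℤ.+ (y ℤ.- x)
  lemma = solve-∀

-- How the difference of two squares changes when their shifts are undone.
unlift : ∀ v D I J s s′ {a b} → a ≡ s ⊕ I · v → b ≡ s′ ⊕ J · v → b ⊖ a ≡ D · v →
         s′ ⊖ s ≡ (D +ᴹ I +ᴹ (-ᴹ J)) · v
unlift v D@(mat _ _ _ _) I@(mat _ _ _ _) J@(mat _ _ _ _) s s′ refl refl eq = begin
  s′ ⊖ s ≡⟨ cong₂ _,_ (lemma (proj₁ s) (proj₁ s′) (proj₁ (I · v)) (proj₁ (J · v)))
                      (lemma (proj₂ s) (proj₂ s′) (proj₂ (I · v)) (proj₂ (J · v))) ⟩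
  ((s′ ⊕ J · v) ⊖ (s ⊕ I · v)) ⊕ I · v ⊕ ((0ℤ , 0ℤ) ⊖ J · v)
    ≡⟨ cong (λ u → u ⊕ I · v ⊕ ((0ℤ , 0ℤ) ⊖ J · v)) eq ⟩
  D · v ⊕ I · v ⊕ ((0ℤ , 0ℤ) ⊖ J · v)
    ≡⟨ cong₂ _⊕_ (·-+ᴹ D I v) (·-neg J v) ⟨
  (D +ᴹ I) · v ⊕ (-ᴹ J) · v
    ≡⟨ ·-+ᴹ (D +ᴹ I) (-ᴹ J) v ⟨
  (D +ᴹ I +ᴹ (-ᴹ J)) · v ∎
  where
  open ≡-Reasoning
  lemma : ∀ s s′ i j → s′ ℤ.- s ≡ (s′ ℤ.+ j) ℤ.- (s ℤ.+ i) ℤ.+ i ℤ.+ (0ℤ ℤ.- j)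
  lemma = solve-∀

regroup : ∀ P D I J → P +ᴹ (D +ᴹ I +ᴹ (-ᴹ J)) +ᴹ J ≡ P +ᴹ I +ᴹ D
regroup (mat p q r s) (mat a b c d) (mat a′ b′ c′ d′) (mat a″ b″ c″ d″) =
  mat≡ (lemma p a a′ a″) (lemma q b b′ b″) (lemma r c c′ c″) (lemma s d d′ d″)
  where
  lemma : ∀ p d i j → p ℤ.+ (d ℤ.+ i ℤ.+ ℤ.- j) ℤ.+ j ≡ p ℤ.+ i ℤ.+ d
  lemma = solve-∀

+ᴹ-identity : ∀ P → P +ᴹ 0ᴹ ≡ P
+ᴹ-identity (mat p q r s) =
  mat≡ (ℤ.+-identityʳ p) (ℤ.+-identityʳ q) (ℤ.+-identityʳ r) (ℤ.+-identityʳ s)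

*ᴹ-distrib : ∀ M N P → (M +ᴹ N) *ᴹ P ≡ M *ᴹ P +ᴹ N *ᴹ P
*ᴹ-distrib (mat a b c d) (mat a′ b′ c′ d′) (mat p q r s) =
  mat≡ (lemma a b a′ b′ p r) (lemma a b a′ b′ q s) (lemma c d c′ d′ p r) (lemma c d c′ d′ q s)
  where
  lemma : ∀ a b c d p r → (a ℤ.+ c) ℤ.* p ℤ.+ (b ℤ.+ d) ℤ.* r ≡
                          a ℤ.* p ℤ.+ b ℤ.* r ℤ.+ (c ℤ.* p ℤ.+ d ℤ.* r)
  lemma = solve-∀

⊖-zero : ∀ s s′ → s′ ⊖ s ≡ (0ℤ , 0ℤ) → s ≡ s′
⊖-zero s s′ eq = sym (trans (⊖⇒⊕ s s′ _ eq) (⊕-identity s))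

-- By induction along the liftings: the move comes from one square before the
-- last lifting, or from a move there.
coordinates-move : ∀ w {a b X Y} d → Coordinates w a X → Coordinates w b Y →
                   b ⊖ a ≡ A d · vec (frame w) → Y ≡ X +ᴹ A d
coordinates-move w {a} {b} d (origin p) y eq =
  contradiction (possible (frame-≤ w) hole (A d) board p
    (subst (InBox board (vec (frame w))) (⊖⇒⊕ a b _ eq) (coordinates⇒board w y))) (hole-no-exit d)
coordinates-move w {a} {b} d x@(lifted _ _ _ _) (origin q) eq =
  contradiction (possible (frame-≤ w) board (A d) hole (coordinates⇒board w x)
    (subst (InBox hole (vec (frame w))) (⊖⇒⊕ a b _ eq) q)) (hole-no-entry d)
coordinates-move (t ∷ w) {a} {b} d (lifted {s = s} {X = X} i p a≡ x)
                 (lifted {s = s′} {X = Y} j q b≡ y) eq =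
  conclude (moves-descend t d i j
    (possible (frame-≤ w) (box i ⋆ U t) (A d *ᴹ U t) (box j ⋆ U t)
      (pull (box i) (U t) {v = vec (frame w)} (subst (λ v → InBox (box i) v a) v≡ p))
      (pull (box j) (U t) {v = vec (frame w)}
        (subst₂ (λ v b → InBox (box j) v b) v≡ b≡′ q))))
  where
  v = vec (frame (t ∷ w))
  v≡ : v ≡ U t · vec (frame w)
  v≡ = lift-vec t (frame-≤ w)
  b≡′ : b ≡ a ⊕ (A d *ᴹ U t) · vec (frame w)
  b≡′ = trans (⊖⇒⊕ a b _ eq)
    (cong (a ⊕_) (trans (cong (A d ·_) v≡) (sym (·-*ᴹ (A d) (U t) _))))
  M = A d +ᴹ V i +ᴹ (-ᴹ V j)
  step : s′ ⊖ s ≡ M · v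
  step = unlift v (A d) (V i) (V j) s s′ a≡ b≡ eq
  conclude : Descends t M → Y *ᴹ T t +ᴹ V j ≡ X *ᴹ T t +ᴹ V i +ᴹ A d
  conclude (inj₁ M≡0) = begin
    Y *ᴹ T t +ᴹ V j      ≡⟨ cong (λ Z → Z *ᴹ T t +ᴹ V j) Y≡X ⟩
    X *ᴹ T t +ᴹ V j
      ≡⟨ cong (_+ᴹ V j) (trans (cong (X *ᴹ T t +ᴹ_) M≡0) (+ᴹ-identity (X *ᴹ T t))) ⟨
    X *ᴹ T t +ᴹ M +ᴹ V j ≡⟨ regroup (X *ᴹ T t) (A d) (V i) (V j) ⟩
    X *ᴹ T t +ᴹ V i +ᴹ A d ∎
    where
    open ≡-Reasoning
    s≡s′ : s ≡ s′
    s≡s′ = ⊖-zero s s′ (trans step (trans (cong (_· v) M≡0) (0-· v)))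
    Y≡X : Y ≡ X
    Y≡X = coordinates-unique w (subst (λ s → Coordinates w s Y) (sym s≡s′) y) x
  conclude (inj₂ (d′ , M≡)) = begin
    Y *ᴹ T t +ᴹ V j
      ≡⟨ cong (λ Z → Z *ᴹ T t +ᴹ V j) (coordinates-move w d′ x y move) ⟩
    (X +ᴹ A d′) *ᴹ T t +ᴹ V j
      ≡⟨ cong (_+ᴹ V j) (*ᴹ-distrib X (A d′) (T t)) ⟩
    X *ᴹ T t +ᴹ A d′ *ᴹ T t +ᴹ V j
      ≡⟨ cong (λ N → X *ᴹ T t +ᴹ N +ᴹ V j) M≡ ⟨
    X *ᴹ T t +ᴹ M +ᴹ V j
      ≡⟨ regroup (X *ᴹ T t) (A d) (V i) (V j) ⟩
    X *ᴹ T t +ᴹ V i +ᴹ A d ∎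
    where
    open ≡-Reasoning
    move : s′ ⊖ s ≡ A d′ · vec (frame w)
    move = trans step (trans (cong (_· v) M≡)
      (trans (·-*ᴹ (A d′) (T t) v) (cong (A d′ ·_) (unlift-vec t (frame-≤ w)))))

-- The square reached from s by undoing a shift is shifted to s.
retract : ∀ M N u {v} s → v ≡ N · u → s ≡ s ⊕ ((-ᴹ M) *ᴹ N) · u ⊕ M · v
retract M N u {v} s v≡ = sym (begin
  s ⊕ ((-ᴹ M) *ᴹ N) · u ⊕ M · v    ≡⟨ cong (λ z → s ⊕ z ⊕ M · v) (·-*ᴹ (-ᴹ M) N u) ⟩
  s ⊕ (-ᴹ M) · (N · u) ⊕ M · v     ≡⟨ cong (λ z → s ⊕ (-ᴹ M) · z ⊕ M · v) v≡ ⟨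
  s ⊕ (-ᴹ M) · v ⊕ M · v           ≡⟨ cong (λ z → s ⊕ z ⊕ M · v) (·-neg M v) ⟩
  s ⊕ ((0ℤ , 0ℤ) ⊖ M · v) ⊕ M · v
    ≡⟨ cong₂ _,_ (lemma (proj₁ s) (proj₁ (M · v))) (lemma (proj₂ s) (proj₂ (M · v))) ⟩
  s ∎)
  where
  open ≡-Reasoning
  lemma : ∀ x y → x ℤ.+ (0ℤ ℤ.- y) ℤ.+ y ≡ x
  lemma = solve-∀

-- By induction: a square outside the hole is a lift of a square of the smaller board.
coordinates-exist : ∀ w s → InBox board (vec (frame w)) s → ∃[ X ] Coordinates w s X
coordinates-exist []      s p = 0ᴹ , origin p
coordinates-exist (t ∷ w) s p = from-location (locate (t ∷ w) s p)
  where
  v = vec (frame (t ∷ w))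
  v≡ : v ≡ U t · vec (frame w)
  v≡ = lift-vec t (frame-≤ w)
  from-location : InBox hole v s ⊎ ∃[ c ] InBox (box c) v s → ∃[ X ] Coordinates (t ∷ w) s X
  from-location (inj₁ q)       = 0ᴹ , origin q
  from-location (inj₂ (c , q)) =
    _ , lifted c q (retract (V c) (U t) (vec (frame w)) s v≡)
      (proj₂ (coordinates-exist w s′ (contained (frame-≤ w) (box c ⋆ U t) back board
        (section-from-board t c)
        (pull (box c) (U t) {v = vec (frame w)} (subst (λ v → InBox (box c) v s) v≡ q)))))
    where
    back = (-ᴹ V c) *ᴹ U t
    s′ = s ⊕ back · vec (frame w)

------------------------------------------------------------------------
-- Basic leapers and the (0 , 1)-frame

OnlyUnitsDivide : ℕ → ℕ → Set
OnlyUnitsDivide p q = ∀ {d} → d ∣ p → d ∣ q → d ≡ 1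

-- For p > 0 the last lifting is g, h or f according to whether q / p is below 2,
-- between 2 and 3, or above 3.  At these bounds coprimality and parity leave
-- only p = 1 and q = 2, where h is used.
descend : ∀ q → Acc _<_ q → ∀ p → p < q → OnlyUnitsDivide p q → ¬ 2 ∣ p ℕ.+ q →
          ∃[ w ] frame w ≡ (p , q)
descend q _ zero p<q coprime odd = [] , cong (0 ,_) (sym (coprime (q ∣0) ∣-refl))
descend q (acc rec) p@(suc _) p<q coprime odd with q ℕ.<? 2 ℕ.* p
... | yes q<2p = g ∷ proj₁ IH ,
        trans (cong (liftFrame g) (proj₂ IH)) (cong (p ,_) (ℕ.m∸[m∸n]≡n (ℕ.<⇒≤ q<2p)))
  where
  m = 2 ℕ.* p ℕ.∸ q
  m+q≡2p : m ℕ.+ q ≡ 2 ℕ.* p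
  m+q≡2p = ℕ.m∸n+n≡m (ℕ.<⇒≤ q<2p)
  m<p : m < p
  m<p = ℕ.+-cancelʳ-< q m p
    (subst (_< p ℕ.+ q) (sym (trans m+q≡2p (cong (p ℕ.+_) (ℕ.+-identityʳ p)))) (ℕ.+-monoʳ-< p p<q))
  coprime′ : OnlyUnitsDivide m p
  coprime′ {d} d∣m d∣p = coprime d∣p (∣m+n∣m⇒∣n (subst (d ∣_) (sym m+q≡2p) (∣n⇒∣m*n 2 d∣p)) d∣m)
  sum : (m ℕ.+ p) ℕ.+ (p ℕ.+ q) ≡ 2 ℕ.* (2 ℕ.* p)
  sum = trans (lemma m p q) (trans (cong (ℕ._+ 2 ℕ.* p) m+q≡2p) (lemma′ p))
    where
    lemma : ∀ m p q → (m ℕ.+ p) ℕ.+ (p ℕ.+ q) ≡ (m ℕ.+ q) ℕ.+ 2 ℕ.* p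
    lemma = ℕ-Solver.solve-∀
    lemma′ : ∀ p → 2 ℕ.* p ℕ.+ 2 ℕ.* p ≡ 2 ℕ.* (2 ℕ.* p)
    lemma′ = ℕ-Solver.solve-∀
  odd′ : ¬ 2 ∣ m ℕ.+ p
  odd′ e = odd (∣m+n∣m⇒∣n (subst (2 ∣_) (sym sum) (m∣m*n (2 ℕ.* p))) e)
  IH = descend p (rec p<q) m m<p coprime′ odd′
... | no q≮2p with ℕ.m+[n∸m]≡n (ℕ.≮⇒≥ q≮2p) | ℕ.<-cmp (q ℕ.∸ 2 ℕ.* p) p
...   | q≡ | tri< k<p _ _ = h ∷ proj₁ IH ,
        trans (cong (liftFrame h) (proj₂ IH)) (cong (p ,_) (trans (ℕ.+-comm k (2 ℕ.* p)) q≡))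
  where
  k = q ℕ.∸ 2 ℕ.* p
  coprime′ : OnlyUnitsDivide k p
  coprime′ {d} d∣k d∣p = coprime d∣p (subst (d ∣_) q≡ (∣m∣n⇒∣m+n (∣n⇒∣m*n 2 d∣p) d∣k))
  odd′ : ¬ 2 ∣ k ℕ.+ p
  odd′ e = odd (subst (2 ∣_) (trans (lemma k p) (cong (p ℕ.+_) q≡)) (∣m∣n⇒∣m+n (m∣m*n p) e))
    where
    lemma : ∀ k p → 2 ℕ.* p ℕ.+ (k ℕ.+ p) ≡ p ℕ.+ (2 ℕ.* p ℕ.+ k)
    lemma = ℕ-Solver.solve-∀
  IH = descend p (rec p<q) k k<p coprime′ odd′
...   | q≡ | tri≈ _ k≡p _ = contradiction
        (subst (λ q → 2 ∣ p ℕ.+ q) (trans (cong (2 ℕ.* p ℕ.+_) (sym k≡p)) q≡)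
          (divides (2 ℕ.* p) (lemma p))) odd
  where
  lemma : ∀ p → p ℕ.+ (2 ℕ.* p ℕ.+ p) ≡ 2 ℕ.* p ℕ.* 2
  lemma = ℕ-Solver.solve-∀
...   | q≡ | tri> _ _ p<k = f ∷ proj₁ IH , trans (cong (liftFrame f) (proj₂ IH)) (cong (p ,_) q≡)
  where
  k = q ℕ.∸ 2 ℕ.* p
  coprime′ : OnlyUnitsDivide p k
  coprime′ {d} d∣p d∣k = coprime d∣p (subst (d ∣_) q≡ (∣m∣n⇒∣m+n (∣n⇒∣m*n 2 d∣p) d∣k))
  odd′ : ¬ 2 ∣ p ℕ.+ k
  odd′ e = odd (subst (2 ∣_) (trans (lemma k p) (cong (p ℕ.+_) q≡)) (∣m∣n⇒∣m+n (m∣m*n p) e))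
    where
    lemma : ∀ k p → 2 ℕ.* p ℕ.+ (p ℕ.+ k) ≡ p ℕ.+ (2 ℕ.* p ℕ.+ k)
    lemma = ℕ-Solver.solve-∀
  k<q : k < q
  k<q = subst (k <_) q≡ (ℕ.m<n+m k (s≤s z≤n))
  IH = descend k (rec k<q) p p<k coprime′ odd′

leaper-frame : (L : Leaper) → ∃[ w ] frame w ≡ (Leaper.p L , Leaper.q L)
leaper-frame L = descend q (<-wellFounded q) p p<q
  (λ d∣p d∣q → ∣1⇒≡1 (subst (_ ∣_) (proj₂ basic) (gcd-greatest d∣p d∣q)))
  (λ 2∣p+q → ℕ.1+n≢0 (trans (sym (proj₁ basic)) (n∣m⇒m%n≡0 (p ℕ.+ q) 2 2∣p+q)))
  where open Leaper L

------------------------------------------------------------------------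
-- The cyclic successor

toℕ-next : ∀ {n} (i : Fin (suc n)) → toℕ (next i) ≡ suc (toℕ i) ℕ.% suc n
toℕ-next {n} i = Fin.toℕ-fromℕ< (m%n<n (suc (toℕ i)) (suc n))

next-inject₁ : ∀ {n} (i : Fin n) → next (inject₁ i) ≡ Fin.suc i
next-inject₁ {n} i = Fin.toℕ-injective (trans (toℕ-next (inject₁ i))
  (trans (cong (λ k → suc k ℕ.% suc n) (Fin.toℕ-inject₁ i)) (m<n⇒m%n≡m (s≤s (Fin.toℕ<n i)))))

next-fromℕ : ∀ n → next (fromℕ n) ≡ Fin.zero
next-fromℕ n = Fin.toℕ-injective (trans (toℕ-next (fromℕ n))
  (trans (cong (λ k → suc k ℕ.% suc n) (Fin.toℕ-fromℕ n)) (n%n≡0 (suc n))))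

next-surjective : ∀ {n} (i : Fin n) → ∃[ j ] next j ≡ i
next-surjective {suc n} Fin.zero    = fromℕ n , next-fromℕ n
next-surjective {suc n} (Fin.suc i) = inject₁ i , next-inject₁ i

next-next-≢ : ∀ {n} → 3 ≤ n → (i : Fin n) → next (next i) ≢ i
next-next-≢ (s≤s (s≤s (s≤s {n = n} _))) i eq with view i
... | ‵fromℕ with trans (sym eq) (trans (cong next (next-fromℕ (suc (suc n))))
                                        (next-inject₁ {suc (suc n)} Fin.zero))
...   | ()
next-next-≢ (s≤s (s≤s (s≤s {n = n} _))) i eq | ‵inject₁ j with view j
... | ‵fromℕ with trans (sym eq) (trans (cong next (next-inject₁ (fromℕ (suc n))))
                                        (next-fromℕ (suc (suc n))))
...   | ()
next-next-≢ (s≤s (s≤s (s≤s {n = n} _))) i eq | ‵inject₁ j | ‵inject₁ k =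
  ℕ.<⇒≢ (ℕ.m<n+m (toℕ k) {2} (s≤s z≤n)) (sym (begin
    suc (suc (toℕ k))              ≡⟨ cong toℕ (next-inject₁ (Fin.suc k)) ⟨
    toℕ (next (inject₁ (Fin.suc k))) ≡⟨ cong (toℕ ∘ next) (next-inject₁ (inject₁ k)) ⟨
    toℕ (next (next i))            ≡⟨ cong toℕ eq ⟩
    toℕ (inject₁ (inject₁ k))      ≡⟨ Fin.toℕ-inject₁ (inject₁ k) ⟩
    toℕ (inject₁ k)                ≡⟨ Fin.toℕ-inject₁ k ⟩
    toℕ k                          ∎))
  where open ≡-Reasoning

------------------------------------------------------------------------
-- Sums along closed walks

+ᴹ-assoc : ∀ M N P → M +ᴹ N +ᴹ P ≡ M +ᴹ (N +ᴹ P)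
+ᴹ-assoc (mat a b c d) (mat a′ b′ c′ d′) (mat a″ b″ c″ d″) =
  mat≡ (ℤ.+-assoc a a′ a″) (ℤ.+-assoc b b′ b″) (ℤ.+-assoc c c′ c″) (ℤ.+-assoc d d′ d″)

+ᴹ-comm : ∀ M N → M +ᴹ N ≡ N +ᴹ M
+ᴹ-comm (mat a b c d) (mat a′ b′ c′ d′) =
  mat≡ (ℤ.+-comm a a′) (ℤ.+-comm b b′) (ℤ.+-comm c c′) (ℤ.+-comm d d′)

+ᴹ-cancelˡ : ∀ M N P → M +ᴹ N ≡ M +ᴹ P → N ≡ P
+ᴹ-cancelˡ (mat a b c d) (mat a′ b′ c′ d′) (mat a″ b″ c″ d″) eq =
  mat≡ (∙-cancelˡ ℤ.+-0-abelianGroup a a′ a″ (cong Matrix.a₁₁ eq))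
       (∙-cancelˡ ℤ.+-0-abelianGroup b b′ b″ (cong Matrix.a₁₂ eq))
       (∙-cancelˡ ℤ.+-0-abelianGroup c c′ c″ (cong Matrix.a₂₁ eq))
       (∙-cancelˡ ℤ.+-0-abelianGroup d d′ d″ (cong Matrix.a₂₂ eq))

sumᴹ-cong : ∀ {n} {φ ψ : Fin n → Matrix} → (∀ i → φ i ≡ ψ i) → sumᴹ φ ≡ sumᴹ ψ
sumᴹ-cong {zero}  eq = refl
sumᴹ-cong {suc n} eq = cong₂ _+ᴹ_ (eq Fin.zero) (sumᴹ-cong (eq ∘ Fin.suc))

sumᴹ-last : ∀ {n} (φ : Fin (suc n) → Matrix) → sumᴹ φ ≡ sumᴹ (φ ∘ inject₁) +ᴹ φ (fromℕ n)
sumᴹ-last {zero}  φ = +ᴹ-comm (φ Fin.zero) 0ᴹ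
sumᴹ-last {suc n} φ = trans (cong (φ Fin.zero +ᴹ_) (sumᴹ-last (φ ∘ Fin.suc)))
                            (sym (+ᴹ-assoc (φ Fin.zero) _ _))

sumᴹ-next : ∀ {n} (φ : Fin (suc n) → Matrix) → sumᴹ (φ ∘ next) ≡ sumᴹ φ
sumᴹ-next {n} φ = begin
  sumᴹ (φ ∘ next)                                         ≡⟨ sumᴹ-last (φ ∘ next) ⟩
  sumᴹ (φ ∘ next ∘ inject₁) +ᴹ φ (next (fromℕ n))
    ≡⟨ cong₂ _+ᴹ_ (sumᴹ-cong (cong φ ∘ next-inject₁)) (cong φ (next-fromℕ n)) ⟩
  sumᴹ (φ ∘ Fin.suc) +ᴹ φ Fin.zero                        ≡⟨ +ᴹ-comm _ (φ Fin.zero) ⟩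
  sumᴹ φ                                                  ∎
  where open ≡-Reasoning

interchange : ∀ M N P Q → M +ᴹ N +ᴹ (P +ᴹ Q) ≡ M +ᴹ P +ᴹ (N +ᴹ Q)
interchange (mat a b c d) (mat a′ b′ c′ d′) (mat a″ b″ c″ d″) (mat a‴ b‴ c‴ d‴) =
  mat≡ (lemma a a′ a″ a‴) (lemma b b′ b″ b‴) (lemma c c′ c″ c‴) (lemma d d′ d″ d‴)
  where
  lemma : ∀ a b c d → a ℤ.+ b ℤ.+ (c ℤ.+ d) ≡ a ℤ.+ c ℤ.+ (b ℤ.+ d)
  lemma = solve-∀

sumᴹ-+ᴹ : ∀ {n} (φ ψ : Fin n → Matrix) → sumᴹ (λ i → φ i +ᴹ ψ i) ≡ sumᴹ φ +ᴹ sumᴹ ψ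
sumᴹ-+ᴹ {zero}  φ ψ = refl
sumᴹ-+ᴹ {suc n} φ ψ =
  trans (cong (φ Fin.zero +ᴹ ψ Fin.zero +ᴹ_) (sumᴹ-+ᴹ (φ ∘ Fin.suc) (ψ ∘ Fin.suc)))
        (interchange (φ Fin.zero) (ψ Fin.zero) (sumᴹ (φ ∘ Fin.suc)) _)

-- The increments of a function around a closed walk add up to zero.
closed-walk : ∀ {n} (φ δ : Fin (suc n) → Matrix) → (∀ i → φ (next i) ≡ φ i +ᴹ δ i) → sumᴹ δ ≡ 0ᴹ
closed-walk φ δ step = +ᴹ-cancelˡ (sumᴹ φ) (sumᴹ δ) 0ᴹ (begin
  sumᴹ φ +ᴹ sumᴹ δ        ≡⟨ sumᴹ-+ᴹ φ δ ⟨
  sumᴹ (λ i → φ i +ᴹ δ i) ≡⟨ sumᴹ-cong step ⟨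
  sumᴹ (φ ∘ next)         ≡⟨ sumᴹ-next φ ⟩
  sumᴹ φ                  ≡⟨ +ᴹ-identity (sumᴹ φ) ⟨
  sumᴹ φ +ᴹ 0ᴹ            ∎)
  where open ≡-Reasoning

------------------------------------------------------------------------
-- Directions of moves

A-injective : ∀ i j → A i ≡ A j → i ≡ j
A-injective = toWitness {a? = all? λ i → all? λ j → (A i ≟ᴹ A j) →-dec (i Fin.≟ j)} _

opposite : ∀ i → ∃[ j ] A j ≡ -ᴹ A i
opposite = toWitness {a? = all? λ i → any? λ j → A j ≟ᴹ (-ᴹ A i)} _

reverse-direction : ∀ {p q} a b i → HasDirection p q a b i → ∃[ j ] HasDirection p q b a j
reverse-direction {p} {q} a b i eq with opposite i
... | j , Aj≡ = j , (begin
  a ⊖ b                     ≡⟨ cong₂ _,_ (lemma (proj₁ a) (proj₁ b)) (lemma (proj₂ a) (proj₂ b)) ⟩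
  (0ℤ , 0ℤ) ⊖ (b ⊖ a)       ≡⟨ cong ((0ℤ , 0ℤ) ⊖_) eq ⟩
  (0ℤ , 0ℤ) ⊖ A i · v       ≡⟨ ·-neg (A i) v ⟨
  (-ᴹ A i) · v              ≡⟨ cong (_· v) Aj≡ ⟨
  A j · v                   ∎)
  where
  open ≡-Reasoning
  v = vec (p , q)
  lemma : ∀ x y → x ℤ.- y ≡ 0ℤ ℤ.- (y ℤ.- x)
  lemma = solve-∀

⊕-⊖ : ∀ a v → (a ⊕ v) ⊖ a ≡ v
⊕-⊖ (x , y) (x′ , y′) = cong₂ _,_ (lemma x x′) (lemma y y′)
  where
  lemma : ∀ x y → x ℤ.+ y ℤ.- x ≡ y
  lemma = solve-∀

±1 : Sign → ℤ
±1 Sign.+ = 1ℤ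
±1 Sign.- = -1ℤ

◃-±1 : ∀ s n → s ◃ n ≡ ±1 s ℤ.* ℤ.+ n
◃-±1 Sign.+ n = trans (ℤ.+◃n≡+n n) (sym (ℤ.*-identityˡ (ℤ.+ n)))
◃-±1 Sign.- n = trans (ℤ.-◃n≡-n n) (sym (ℤ.-1*i≡-i (ℤ.+ n)))

-- The moves by (± p , ± q).
direct : ∀ s t → ∃[ i ] A i ≡ mat (±1 s) 0ℤ 0ℤ (±1 t)
direct Sign.+ Sign.+ = 1F , refl
direct Sign.- Sign.+ = 2F , refl
direct Sign.- Sign.- = 5F , refl
direct Sign.+ Sign.- = 6F , refl

-- The moves by (± q , ± p).
crossed : ∀ s t → ∃[ i ] A i ≡ mat 0ℤ (±1 s) (±1 t) 0ℤ
crossed Sign.+ Sign.+ = 0F , refl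
crossed Sign.- Sign.+ = 3F , refl
crossed Sign.- Sign.- = 4F , refl
crossed Sign.+ Sign.- = 7F , refl

adjacent⇒direction : ∀ {p q} a b → Adjacent p q a b → ∃[ i ] HasDirection p q a b i
adjacent⇒direction {p} {q} a b (s , t , inj₁ eq) with direct s t
... | i , Ai≡ = i , trans (cong (_⊖ a) eq) (trans (⊕-⊖ a _) (trans
        (cong₂ _,_ (trans (◃-±1 s p) (lemma (±1 s) (ℤ.+ p) (ℤ.+ q)))
                   (trans (◃-±1 t q) (lemma′ (±1 t) (ℤ.+ p) (ℤ.+ q))))
        (cong (_· vec (p , q)) (sym Ai≡))))
  where
  lemma : ∀ s x y → s ℤ.* x ≡ s ℤ.* x ℤ.+ 0ℤ ℤ.* y
  lemma = solve-∀
  lemma′ : ∀ t x y → t ℤ.* y ≡ 0ℤ ℤ.* x ℤ.+ t ℤ.* y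
  lemma′ = solve-∀
adjacent⇒direction {p} {q} a b (s , t , inj₂ eq) with crossed s t
... | i , Ai≡ = i , trans (cong (_⊖ a) eq) (trans (⊕-⊖ a _) (trans
        (cong₂ _,_ (trans (◃-±1 s q) (lemma′ (±1 s) (ℤ.+ p) (ℤ.+ q)))
                   (trans (◃-±1 t p) (lemma (±1 t) (ℤ.+ p) (ℤ.+ q))))
        (cong (_· vec (p , q)) (sym Ai≡))))
  where
  lemma : ∀ s x y → s ℤ.* x ≡ s ℤ.* x ℤ.+ 0ℤ ℤ.* y
  lemma = solve-∀
  lemma′ : ∀ t x y → t ℤ.* y ≡ 0ℤ ℤ.* x ℤ.+ t ℤ.* y
  lemma′ = solve-∀

------------------------------------------------------------------------
-- Triviality and balance

-- A matrix at every square of a cycle, increasing by A i along moves of direction i.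
record Potential {p q} (C : Cycle p q) : Set where
  open Cycle C
  field
    φ    : Fin size → Matrix
    step : ∀ a b i → HasDirection p q (square a) (square b) i → φ b ≡ φ a +ᴹ A i

potential⇒trivial : ∀ {p q} (C : Cycle p q) → Potential C → Trivial C
potential⇒trivial C P = go 3≤size square adjacent φ step
  where
  open Cycle C
  open Potential P
  go : ∀ {p q n} → 3 ≤ n →
       (sq : Fin n → Square) → (∀ i → Adjacent p q (sq i) (sq (next i))) →
       (φ : Fin n → Matrix) → (∀ a b i → HasDirection p q (sq a) (sq b) i → φ b ≡ φ a +ᴹ A i) →
       ∃[ d ] ((∀ i → HasDirection p q (sq i) (sq (next i)) (d i)) × sumᴹ (A ∘ d) ≡ 0ᴹ)
  go {n = suc n} _ sq adj φ step =
    (λ i → proj₁ (dir i)) , (λ i → proj₂ (dir i)) ,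
    closed-walk φ (λ i → A (proj₁ (dir i))) (λ i → step i (next i) (proj₁ (dir i)) (proj₂ (dir i)))
    where
    dir = λ i → adjacent⇒direction (sq i) (sq (next i)) (adj i)

potential⇒directionGraph : ∀ {p q} (C : Cycle p q) → Potential C → IsDirectionGraph (extracted C)
potential⇒directionGraph C P = record
  { symmetric    = λ { {a} {b} {i} (e , δ) →
                     let (j , δ′) = reverse-direction (square a) (square b) i δ
                     in j , swap e , δ′ }
  ; unique-label = λ { {a} {b} {i} {j} (_ , δ) (_ , δ′) →
                     A-injective i j (+ᴹ-cancelˡ (φ a) (A i) (A j)
                       (trans (sym (step a b i δ)) (step a b j δ′))) }
  ; balanced     = λ n v d _ arc → closed-walk (φ ∘ v) (A ∘ d)
                     (λ i → step (v i) (v (next i)) (d i) (proj₂ (arc i)))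
  }
  where
  open Cycle C
  open Potential P

⊖-cancelʳ : ∀ a b c → (b ⊖ c) ⊖ (a ⊖ c) ≡ b ⊖ a
⊖-cancelʳ a b c =
  cong₂ _,_ (lemma (proj₁ a) (proj₁ b) (proj₁ c)) (lemma (proj₂ a) (proj₂ b) (proj₂ c))
  where
  lemma : ∀ a b c → (b ℤ.- c) ℤ.- (a ℤ.- c) ≡ b ℤ.- a
  lemma = solve-∀

module _ {L : Leaper} (C : BoardCycle L) where
  open Leaper L
  open BoardCycle C
  open Cycle cycle

  -- The squares of the cycle, moved to the board centred at the origin.
  relative : Fin size → Square
  relative a = square a ⊖ centre

  relative-direction : ∀ a b i → HasDirection p q (square a) (square b) i →
                       relative b ⊖ relative a ≡ A i · vec (p , q)
  relative-direction a b i = trans (⊖-cancelʳ (square a) (square b) centre)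

  within-box : ∀ a → InBox board (vec (p , q)) (relative a)
  within-box a = board⇒box {p} {q} (within a)

  boardCycle-potential : Potential cycle
  boardCycle-potential = record
    { φ    = λ a → proj₁ (pot a)
    ; step = λ a b i δ → coordinates-move w i (proj₂ (pot a)) (proj₂ (pot b))
               (trans (relative-direction a b i δ) (cong (λ F → A i · vec F) (sym w≡)))
    }
    where
    w = proj₁ (leaper-frame L)
    w≡ : frame w ≡ (p , q)
    w≡ = proj₂ (leaper-frame L)
    pot : ∀ a → ∃[ X ] Coordinates w (relative a) X
    pot a = coordinates-exist w (relative a)
      (subst (λ F → InBox board (vec F) (relative a)) (sym w≡) (within-box a))

------------------------------------------------------------------------
-- Squares have degree at most two

module _ {L : Leaper} (C : BoardCycle L) where
  open Leaper L
  open BoardCycle C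
  open Cycle cycle

  private
    v = vec (p , q)
    p≤q = ℕ.<⇒≤ p<q

    possible-move : ∀ B a b i → InBox B v (relative C a) →
                    HasDirection p q (square a) (square b) i → Possible B (A i) board
    possible-move B a b i r δ = possible p≤q B (A i) board r
      (subst (InBox board v)
        (⊖⇒⊕ (relative C a) (relative C b) _ (relative-direction C a b i δ)) (within-box C b))

    same-end : ∀ a b c i j → HasDirection p q (square a) (square b) i →
               HasDirection p q (square a) (square c) j → i ≡ j → b ≡ c
    same-end a b c i .i δ ε refl = injective
      (trans (⊖⇒⊕ (square a) (square b) _ δ) (sym (⊖⇒⊕ (square a) (square c) _ ε)))

    among-two : ∀ {d₁ d₂ x y z : Direction} → x ≢ y → x ≡ d₁ ⊎ x ≡ d₂ → y ≡ d₁ ⊎ y ≡ d₂ →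
                z ≡ d₁ ⊎ z ≡ d₂ → z ≡ x ⊎ z ≡ y
    among-two x≢y (inj₁ refl) (inj₁ refl) _           = contradiction refl x≢y
    among-two x≢y (inj₂ refl) (inj₂ refl) _           = contradiction refl x≢y
    among-two x≢y (inj₁ refl) (inj₂ refl) z           = z
    among-two x≢y (inj₂ refl) (inj₁ refl) (inj₁ refl) = inj₂ refl
    among-two x≢y (inj₂ refl) (inj₁ refl) (inj₂ refl) = inj₁ refl

  -- Squares of the cycle joined by a move follow each other in the cycle.
  consecutive : ∀ a b i → HasDirection p q (square a) (square b) i → b ≡ next a ⊎ a ≡ next b
  consecutive a b i δ = from-location
    (subst (λ F → InBox hole (vec F) (relative C a) ⊎
                  ∃[ c ] InBox (box c) (vec F) (relative C a)) w≡
      (locate w (relative C a)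
        (subst (λ F → InBox board (vec F) (relative C a)) (sym w≡) (within-box C a))))
    where
    w = proj₁ (leaper-frame L)
    w≡ : frame w ≡ (p , q)
    w≡ = proj₂ (leaper-frame L)
    n = next a
    z = proj₁ (next-surjective a)
    z≡ : next z ≡ a
    z≡ = proj₂ (next-surjective a)
    forward : ∃[ j ] HasDirection p q (square a) (square n) j
    forward = adjacent⇒direction (square a) (square n) (adjacent a)
    backward : ∃[ j ] HasDirection p q (square a) (square z) j
    backward = let (j , δ) = adjacent⇒direction (square z) (square (next z)) (adjacent z) in
      reverse-direction (square z) (square a) j
        (subst (λ k → HasDirection p q (square z) (square k) j) z≡ δ)
    distinct : proj₁ forward ≢ proj₁ backward
    distinct eq = next-next-≢ 3≤size a
      (trans (cong next (same-end a n z _ _ (proj₂ forward) (proj₂ backward) eq)) z≡)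
    from-location : InBox hole v (relative C a) ⊎ ∃[ c ] InBox (box c) v (relative C a) →
                    b ≡ next a ⊎ a ≡ next b
    from-location (inj₁ r)       = contradiction (possible-move hole a b i r δ) (hole-no-exit i)
    from-location (inj₂ (c , r)) =
      conclude (among-two distinct (choose n _ (proj₂ forward)) (choose z _ (proj₂ backward))
                                   (choose b i δ))
      where
      choose : ∀ b i → HasDirection p q (square a) (square b) i →
               i ≡ proj₁ (two-moves c) ⊎ i ≡ proj₁ (proj₂ (two-moves c))
      choose b i δ = proj₂ (proj₂ (two-moves c)) i (possible-move (box c) a b i r δ)
      conclude : i ≡ proj₁ forward ⊎ i ≡ proj₁ backward → b ≡ next a ⊎ a ≡ next b
      conclude (inj₁ eq) = inj₁ (same-end a b n i _ δ (proj₂ forward) eq)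
      conclude (inj₂ eq) = inj₂ (trans (sym z≡)
        (cong next (sym (same-end a b z i _ δ (proj₂ backward) eq))))

------------------------------------------------------------------------
-- Graphs determined by a set of matrices

-- The positions along C correspond to the matrices in R, and the arcs to the
-- pairs of matrices that differ by a direction matrix.
record Chart {p q} (C : Cycle p q) (R : Matrix → Set) : Set where
  open Cycle C
  field
    coord           : Fin size → Matrix
    coord-injective : ∀ a b → coord a ≡ coord b → a ≡ b
    reached         : ∀ a → R (coord a)
    position        : ∀ X → R X → ∃[ a ] coord a ≡ X
    arc             : ∀ a b i → LabelledDigraph.Arc (extracted C) a b i ⇔
                                coord b ≡ coord a +ᴹ A i

charts⇒≅ : ∀ {p q p′ q′ R} {C : Cycle p q} {C′ : Cycle p′ q′} → Chart C R → Chart C′ R →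
           extracted C ≅ extracted C′
charts⇒≅ {C = C} {C′} K K′ = record
  { vertices = mk↔ₛ′ to from
      (λ b → K′.coord-injective _ _ (trans (to-coord (from b)) (from-coord b)))
      (λ a → K.coord-injective _ _ (trans (from-coord (to a)) (to-coord a)))
  ; arcs = λ a b i → mk⇔
      (λ α → Equivalence.from (K′.arc (to a) (to b) i)
        (subst₂ (λ X Y → Y ≡ X +ᴹ A i) (sym (to-coord a)) (sym (to-coord b))
          (Equivalence.to (K.arc a b i) α)))
      (λ α → Equivalence.from (K.arc a b i)
        (subst₂ (λ X Y → Y ≡ X +ᴹ A i) (to-coord a) (to-coord b)
          (Equivalence.to (K′.arc (to a) (to b) i) α)))
  }
  where
  module K  = Chart K
  module K′ = Chart K′
  to = λ a → proj₁ (K′.position (K.coord a) (K.reached a))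
  to-coord : ∀ a → K′.coord (to a) ≡ K.coord a
  to-coord a = proj₂ (K′.position (K.coord a) (K.reached a))
  from = λ b → proj₁ (K.position (K′.coord b) (K′.reached b))
  from-coord : ∀ b → K.coord (from b) ≡ K′.coord b
  from-coord b = proj₂ (K.position (K′.coord b) (K′.reached b))

------------------------------------------------------------------------
-- Matrices reached by a string of liftings from a square of the hole

-- Reach e c X: apply to a square of the hole a lifting that takes it into all
-- eight sections, and then the liftings e.  Some resulting square lies in the
-- section c and differs from the initial square by X times the proportions.
-- No leaper enters, as it depends only on t, c and i whether a square of the
-- section c has a lift into the section i.
data Reach : List Lifting → Compass → Matrix → Set where
  base : ∀ c → Reach [] c (V c)
  step : ∀ {t e c X} i → Reach e c X → Possible (box c) (V i *ᴹ U t) (box i ⋆ U t) →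
         Reach (t ∷ e) i (X *ᴹ T t +ᴹ V i)

-- A square of the hole has lifts of type t into all eight sections.
FromHole : Lifting → Set
FromHole t = ∀ c → Contained hole (V c *ᴹ U t) (box c ⋆ U t)

abstract
  -- A section is shifted either into a section or entirely outside of it.
  lift-exact : ∀ t c i → Possible (box c) (V i *ᴹ U t) (box i ⋆ U t) →
               Contained (box c) (V i *ᴹ U t) (box i ⋆ U t)
  lift-exact = toWitness {a? = allLifting? λ t → allCompass? λ c → allCompass? λ i →
    possible? (box c) (V i *ᴹ U t) (box i ⋆ U t) →-dec
    contained? (box c) (V i *ᴹ U t) (box i ⋆ U t)} _

  fromHole-g : FromHole g
  fromHole-g = toWitness {a? = allCompass? λ c → contained? hole (V c *ᴹ U g) (box c ⋆ U g)} _

  fromHole-h : FromHole h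
  fromHole-h = toWitness {a? = allCompass? λ c → contained? hole (V c *ᴹ U h) (box c ⋆ U h)} _

displace : ∀ t w i → (V i *ᴹ U t) · vec (frame w) ≡ V i · vec (frame (t ∷ w))
displace t w i = trans (·-*ᴹ (V i) (U t) (vec (frame w)))
                       (cong (V i ·_) (sym (lift-vec t (frame-≤ w))))

into-section : ∀ t w B i s → Contained B (V i *ᴹ U t) (box i ⋆ U t) →
               InBox B (vec (frame w)) s →
               InBox (box i) (vec (frame (t ∷ w))) (s ⊕ V i · vec (frame (t ∷ w)))
into-section t w B i s c p = subst₂ (λ v s → InBox (box i) v s)
  (sym (lift-vec t (frame-≤ w))) (cong (s ⊕_) (displace t w i))
  (push (box i) (U t) {v = vec (frame w)}
    (contained (frame-≤ w) B (V i *ᴹ U t) (box i ⋆ U t) c p))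

0-*ᴹ : ∀ M N → 0ᴹ *ᴹ M +ᴹ N ≡ N
0-*ᴹ M N = trans (+ᴹ-comm (0ᴹ *ᴹ M) N) (+ᴹ-identity N)

⊕-assoc : ∀ a b c → a ⊕ b ⊕ c ≡ a ⊕ (b ⊕ c)
⊕-assoc (x , y) (x′ , y′) (x″ , y″) = cong₂ _,_ (ℤ.+-assoc x x′ x″) (ℤ.+-assoc y y′ y″)

lift-position : ∀ t w s X i → let v = vec (frame (t ∷ w)) in
                s ⊕ X · vec (frame w) ⊕ V i · v ≡ s ⊕ (X *ᴹ T t +ᴹ V i) · v
lift-position t w s X i = begin
  s ⊕ X · vec (frame w) ⊕ V i · v
    ≡⟨ ⊕-assoc s (X · vec (frame w)) (V i · v) ⟩
  s ⊕ (X · vec (frame w) ⊕ V i · v)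
    ≡⟨ cong (λ u → s ⊕ (X · u ⊕ V i · v)) (unlift-vec t (frame-≤ w)) ⟨
  s ⊕ (X · (T t · v) ⊕ V i · v)
    ≡⟨ cong (λ u → s ⊕ (u ⊕ V i · v)) (·-*ᴹ X (T t) v) ⟨
  s ⊕ ((X *ᴹ T t) · v ⊕ V i · v)
    ≡⟨ cong (s ⊕_) (·-+ᴹ (X *ᴹ T t) (V i) v) ⟨
  s ⊕ (X *ᴹ T t +ᴹ V i) · v ∎
  where
  open ≡-Reasoning
  v = vec (frame (t ∷ w))

-- Cycles that arise from the square s₀ of the hole of the frame r: the lifting x
-- yields a shell cycle, and the liftings e yield the cycle considered.
module Seeded (x : Lifting) (fromHole : FromHole x) (r : List Lifting) (s₀ : Square)
              (s₀∈hole : InBox hole (vec (frame r)) s₀) where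

  word : List Lifting → List Lifting
  word e = e ++ x ∷ r

  place : List Lifting → Matrix → Square
  place e X = s₀ ⊕ X · vec (frame (word e))

  reach⇒box : ∀ e {c X} → Reach e c X → InBox (box c) (vec (frame (word e))) (place e X)
  reach⇒box [] (base c) = into-section x r hole c s₀ (fromHole c) s₀∈hole
  reach⇒box (t ∷ e) (step {c = c} {X} i R p) =
    subst (InBox (box i) (vec (frame (word (t ∷ e))))) (lift-position t (word e) s₀ X i)
      (into-section t (word e) (box c) i (place e X) (lift-exact t c i p) (reach⇒box e R))

  reach⇒coordinates : ∀ e {c X} → Reach e c X → Coordinates (word e) (place e X) X
  reach⇒coordinates [] (base c) = subst (Coordinates (x ∷ r) (place [] (V c))) (0-*ᴹ (T x) (V c))
    (lifted c (reach⇒box [] (base c)) refl (origin s₀∈hole))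
  reach⇒coordinates (t ∷ e) R@(step {X = X} i R′ _) =
    lifted i (reach⇒box (t ∷ e) R) (sym (lift-position t (word e) s₀ X i)) (reach⇒coordinates e R′)

  -- S is the set of the eight lifts of s₀.
  module _ (S : Pred Square 0ℓ) (S⇔ : ∀ s → S s ⇔ (∃[ c ] s ≡ place [] (V c))) where

    private
      frame≡ : ∀ e → frame (word e) ≡ liftFrames e (frame (x ∷ r))
      frame≡ e = foldr-++ liftFrame (0 , 1) e (x ∷ r)

    lifts⇒reach : ∀ e s → lifts e (frame (x ∷ r)) S s →
                  ∃[ c ] ∃[ X ] (Reach e c X × s ≡ place e X)
    lifts⇒reach [] s p = let (c , eq) = Equivalence.to (S⇔ s) p in c , V c , base c , eq
    lifts⇒reach (t ∷ e) s p =
      unpack (subst (λ F → lift t F (lifts e (frame (x ∷ r)) S) s) (sym (frame≡ e)) p)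
      where
      v = vec (frame (word (t ∷ e)))
      unpack : lift t (frame (word e)) (lifts e (frame (x ∷ r)) S) s →
               ∃[ c ] ∃[ X ] (Reach (t ∷ e) c X × s ≡ place (t ∷ e) X)
      unpack (i , s∈ , s′∈) with lifts⇒reach e _ s′∈
      ... | c , X , R , eq =
        i , X *ᴹ T t +ᴹ V i , step i R p′ , trans s≡ (lift-position t (word e) s₀ X i)
        where
        w≤ = frame-≤ (word e)
        s≡ : s ≡ place e X ⊕ V i · v
        s≡ = trans (undo s (shift t (frame (word e)) i)) (cong₂ _⊕_ eq (shift-V t w≤ i))
          where
          undo : ∀ s u → s ≡ (s ⊖ u) ⊕ u
          undo (a , b) (c , d) = cong₂ _,_ (lemma a c) (lemma b d)
            where
            lemma : ∀ a c → a ≡ a ℤ.- c ℤ.+ c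
            lemma = solve-∀
        p′ : Possible (box c) (V i *ᴹ U t) (box i ⋆ U t)
        p′ = possible w≤ (box c) (V i *ᴹ U t) (box i ⋆ U t) (reach⇒box e R)
          (pull (box i) (U t) {v = vec (frame (word e))}
            (subst₂ (λ v s → InBox (box i) v s) (lift-vec t w≤)
              (trans s≡ (cong (place e X ⊕_) (sym (displace t (word e) i))))
              (section⇒box (frame (word (t ∷ e))) i s∈)))

    reach⇒lifts : ∀ e {c X} → Reach e c X → lifts e (frame (x ∷ r)) S (place e X)
    reach⇒lifts [] (base c) = Equivalence.from (S⇔ (place [] (V c))) (c , refl)
    reach⇒lifts (t ∷ e) R@(step {X = X} i R′ _) =
      subst (λ F → lift t F (lifts e (frame (x ∷ r)) S) (place (t ∷ e) (X *ᴹ T t +ᴹ V i)))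
        (frame≡ e)
        (i , box⇒section (frame (word (t ∷ e))) i (reach⇒box (t ∷ e) R) ,
         subst (lifts e (frame (x ∷ r)) S) s≡ (reach⇒lifts e R′))
      where
      s≡ : place e X ≡ place (t ∷ e) (X *ᴹ T t +ᴹ V i) ⊖ shift t (frame (word e)) i
      s≡ = sym (trans (cong₂ _⊖_ (sym (lift-position t (word e) s₀ X i))
                                 (shift-V t (frame-≤ (word e)) i))
                      (undo (place e X) (V i · vec (frame (word (t ∷ e))))))
        where
        undo : ∀ s u → (s ⊕ u) ⊖ u ≡ s
        undo (a , b) (c , d) = cong₂ _,_ (lemma a c) (lemma b d)
          where
          lemma : ∀ a c → a ℤ.+ c ℤ.- c ≡ a
          lemma = solve-∀

    module _ {L : Leaper} (C : BoardCycle L) (e : List Lifting)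
             (w≡ : frame (word e) ≡ (Leaper.p L , Leaper.q L))
             (lifted⇔ : ∀ s → squares (BoardCycle.cycle C) (s ⊕ BoardCycle.centre C) ⇔
                              lifts e (frame (x ∷ r)) S s) where
      open Leaper L
      open BoardCycle C
      open Cycle cycle

      private
        back : ∀ s c → (s ⊖ c) ⊕ c ≡ s
        back (a , b) (c , d) = cong₂ _,_ (lemma a c) (lemma b d)
          where
          lemma : ∀ a c → a ℤ.- c ℤ.+ c ≡ a
          lemma = solve-∀

        forth : ∀ s c → (s ⊕ c) ⊖ c ≡ s
        forth (a , b) (c , d) = cong₂ _,_ (lemma a c) (lemma b d)
          where
          lemma : ∀ a c → a ℤ.+ c ℤ.- c ≡ a
          lemma = solve-∀

        found : ∀ a → ∃[ c ] ∃[ X ] (Reach e c X × relative C a ≡ place e X)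
        found a = lifts⇒reach e (relative C a)
          (Equivalence.to (lifted⇔ (relative C a)) (a , sym (back (square a) centre)))

        coord : Fin size → Matrix
        coord a = proj₁ (proj₂ (found a))

        place-coord : ∀ a → relative C a ≡ place e (coord a)
        place-coord a = proj₂ (proj₂ (proj₂ (found a)))

        pot : ∀ a → Coordinates (word e) (relative C a) (coord a)
        pot a = subst (λ s → Coordinates (word e) s (coord a)) (sym (place-coord a))
          (reach⇒coordinates e (proj₁ (proj₂ (proj₂ (found a)))))

        relative-injective : ∀ a b → relative C a ≡ relative C b → a ≡ b
        relative-injective a b eq = injective
          (trans (sym (back (square a) centre))
            (trans (cong (_⊕ centre) eq) (back (square b) centre)))

        position : ∀ X → ∃[ c ] Reach e c X → ∃[ a ] coord a ≡ X
        position X (c , R) with Equivalence.from (lifted⇔ (place e X)) (reach⇒lifts e R)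
        ... | a , eq = a , coordinates-unique (word e) (pot a)
          (subst (λ s → Coordinates (word e) s X)
            (trans (sym (forth (place e X) centre)) (cong (_⊖ centre) (sym eq)))
            (reach⇒coordinates e R))

        move : ∀ a b i → coord b ≡ coord a +ᴹ A i → HasDirection p q (square a) (square b) i
        move a b i eq = begin
          square b ⊖ square a
            ≡⟨ ⊖-cancelʳ (square a) (square b) centre ⟨
          relative C b ⊖ relative C a
            ≡⟨ cong₂ _⊖_ (trans (place-coord b) (cong (place e) eq)) (place-coord a) ⟩
          (s₀ ⊕ (coord a +ᴹ A i) · v) ⊖ (s₀ ⊕ coord a · v)
            ≡⟨ cong (λ u → (s₀ ⊕ u) ⊖ (s₀ ⊕ coord a · v)) (·-+ᴹ (coord a) (A i) v) ⟩
          (s₀ ⊕ (coord a · v ⊕ A i · v)) ⊖ (s₀ ⊕ coord a · v)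
            ≡⟨ cong (_⊖ (s₀ ⊕ coord a · v)) (⊕-assoc s₀ (coord a · v) (A i · v)) ⟨
          (s₀ ⊕ coord a · v ⊕ A i · v) ⊖ (s₀ ⊕ coord a · v)
            ≡⟨ ⊕-⊖ (s₀ ⊕ coord a · v) (A i · v) ⟩
          A i · v
            ≡⟨ cong (λ F → A i · vec F) w≡ ⟩
          A i · vec (p , q) ∎
          where
          open ≡-Reasoning
          v = vec (frame (word e))

      chart : Chart cycle (λ X → ∃[ c ] Reach e c X)
      chart = record
        { coord           = coord
        ; coord-injective = λ a b eq → relative-injective a b
            (trans (place-coord a) (trans (cong (place e) eq) (sym (place-coord b))))
        ; reached         = λ a → proj₁ (found a) , proj₁ (proj₂ (proj₂ (found a)))
        ; position        = position
        ; arc             = λ a b i → mk⇔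
            (λ (_ , δ) → coordinates-move (word e) i (pot a) (pot b)
              (trans (relative-direction C a b i δ) (cong (λ F → A i · vec F) (sym w≡))))
            (λ eq → consecutive C a b i (move a b i eq) , move a b i eq)
        }

------------------------------------------------------------------------
-- Shell cycles

encode : Compass → Fin 8
encode (edge , k)   = k ↑ˡ 4
encode (corner , k) = 4 ↑ʳ k

encode-injective : ∀ c c′ → encode c ≡ encode c′ → c ≡ c′
encode-injective = toWitness {a? = allCompass? λ c → allCompass? λ c′ →
  (encode c Fin.≟ encode c′) →-dec (c ≟ᶜ c′)} _

injective⇒onto : ∀ {n} (k : Fin n → Fin n) → (∀ i j → k i ≡ k j → i ≡ j) → ∀ y → ∃[ i ] k i ≡ y
injective⇒onto {suc n} k k-injective y with any? (λ i → k i Fin.≟ y)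
... | yes hit = hit
... | no miss = contradiction (Fin.injective⇒≤ {f = λ i → punchOut (avoid i)} injective′)
                              (ℕ.<⇒≱ ℕ.≤-refl)
  where
  avoid : ∀ i → y ≢ k i
  avoid i y≡ = miss (i , sym y≡)
  injective′ : Injective _≡_ _≡_ (λ i → punchOut (avoid i))
  injective′ {i} {j} eq = k-injective i j (Fin.punchOut-injective (avoid i) (avoid j) eq)

-- The subboards of the shell for n ≤ 2m and for 2m ≤ n ≤ 3m.  These frames are
-- obtained by g and h respectively, and each subboard is the shifted hole of the
-- frame before that lifting.
shellBox-g shellBox-h : Kind → Box
shellBox-g edge   = ((-1ℤ , 1ℤ) , (ℤ.- ℤ.+ 3 , ℤ.+ 3)) , midᴵ
shellBox-g corner = ((ℤ.+ 3 , -1ℤ) , (1ℤ , 1ℤ)) , ((ℤ.+ 3 , -1ℤ) , (1ℤ , 1ℤ))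
shellBox-h edge   = ((ℤ.- ℤ.+ 5 , ℤ.+ 3) , (1ℤ , 1ℤ)) , ((ℤ.- ℤ.+ 3 , 1ℤ) , (ℤ.+ 3 , -1ℤ))
shellBox-h corner = ((-1ℤ , 1ℤ) , (ℤ.+ 5 , -1ℤ)) , ((-1ℤ , 1ℤ) , (ℤ.+ 5 , -1ℤ))

turned : (Kind → Box) → Compass → Box
turned B (κ , k) = fold (B κ) turn (toℕ k)

abstract
  shell-g-to-hole : ∀ c → Contained (turned shellBox-g c ⋆ U g) ((-ᴹ V c) *ᴹ U g) hole
  shell-g-to-hole = toWitness {a? = allCompass? λ c →
    contained? (turned shellBox-g c ⋆ U g) ((-ᴹ V c) *ᴹ U g) hole} _

  shell-h-to-hole : ∀ c → Contained (turned shellBox-h c ⋆ U h) ((-ᴹ V c) *ᴹ U h) hole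
  shell-h-to-hole = toWitness {a? = allCompass? λ c →
    contained? (turned shellBox-h c ⋆ U h) ((-ᴹ V c) *ᴹ U h) hole} _

-- s is a lift, into some section of G, of a square of the hole of F.
FromSeed : Proportions → Proportions → Square → Set
FromSeed F G s = ∃[ c ] ∃[ s′ ] (InBox hole (vec F) s′ × s ≡ s′ ⊕ V c · vec G)

seed : ∀ t B → (∀ c → Contained (turned B c ⋆ U t) ((-ᴹ V c) *ᴹ U t) hole) →
       ∀ {m n} → m ≤ n → ∀ G → vec G ≡ U t · vec (m , n) →
       ∀ c s → InBox (turned B c) (vec G) s → FromSeed (m , n) G s
seed t B to-hole {m} {n} m≤n G G≡ c s p =
  c , s ⊕ back · vec (m , n) ,
  contained m≤n (turned B c ⋆ U t) back hole (to-hole c)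
    (pull (turned B c) (U t) {v = vec (m , n)} (subst (λ v → InBox (turned B c) v s) G≡ p)) ,
  retract (V c) (U t) (vec (m , n)) s G≡
  where
  back = (-ᴹ V c) *ᴹ U t

⊖-form : ∀ a m b n → (a ℕ.* m) ℤ.⊖ (b ℕ.* n) ≡ ℤ.+ a ℤ.* ℤ.+ m ℤ.- ℤ.+ b ℤ.* ℤ.+ n
⊖-form a m b n = trans (sym (ℤ.m-n≡m⊖n (a ℕ.* m) (b ℕ.* n)))
                       (cong₂ ℤ._-_ (ℤ.pos-* a m) (ℤ.pos-* b n))

three-times : ∀ m n → ℤ.+ 3 ℤ.* (n ℤ.⊖ m) ≡ ⟪ ℤ.- ℤ.+ 3 , ℤ.+ 3 ⟫ vec (m , n)
three-times m n = trans (cong (ℤ.+ 3 ℤ.*_) (sym (ℤ.m-n≡m⊖n n m))) (lemma (ℤ.+ m) (ℤ.+ n))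
  where
  lemma : ∀ m n → ℤ.+ 3 ℤ.* (n ℤ.- m) ≡ ℤ.- ℤ.+ 3 ℤ.* m ℤ.+ ℤ.+ 3 ℤ.* n
  lemma = solve-∀

multiple⊖ : ∀ a m n → (a ℕ.* m) ℤ.⊖ n ≡ ⟪ ℤ.+ a , -1ℤ ⟫ vec (m , n)
multiple⊖ a m n = trans (cong ((a ℕ.* m) ℤ.⊖_) (sym (ℕ.*-identityˡ n)))
  (trans (⊖-form a m 1 n) (lemma (ℤ.+ a) (ℤ.+ m) (ℤ.+ n)))
  where
  lemma : ∀ a m n → a ℤ.* m ℤ.- 1ℤ ℤ.* n ≡ a ℤ.* m ℤ.+ -1ℤ ℤ.* n
  lemma = solve-∀

⊖multiple : ∀ a m n → n ℤ.⊖ (a ℕ.* m) ≡ ⟪ ℤ.- ℤ.+ a , 1ℤ ⟫ vec (m , n)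
⊖multiple a m n = trans (cong (ℤ._⊖ (a ℕ.* m)) (sym (ℕ.*-identityˡ n)))
  (trans (⊖-form 1 n a m) (lemma (ℤ.+ a) (ℤ.+ m) (ℤ.+ n)))
  where
  lemma : ∀ a m n → 1ℤ ℤ.* n ℤ.- a ℤ.* m ≡ ℤ.- a ℤ.* m ℤ.+ 1ℤ ℤ.* n
  lemma = solve-∀

multiple⊖multiple : ∀ m n → (3 ℕ.* n) ℤ.⊖ (5 ℕ.* m) ≡ ⟪ ℤ.- ℤ.+ 5 , ℤ.+ 3 ⟫ vec (m , n)
multiple⊖multiple m n = trans (⊖-form 3 n 5 m) (lemma (ℤ.+ m) (ℤ.+ n))
  where
  lemma : ∀ m n → ℤ.+ 3 ℤ.* n ℤ.- ℤ.+ 5 ℤ.* m ≡ ℤ.- ℤ.+ 5 ℤ.* m ℤ.+ ℤ.+ 3 ℤ.* n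
  lemma = solve-∀

Shape : (Kind → Box) → Proportions → Square → Set
Shape B G s = ∃[ c ] InBox (turned B c) (vec G) s

shell-shape : ∀ m n s → s ∈ Shell (m , n) →
              (n ≤ 2 ℕ.* m × Shape shellBox-g (m , n) s) ⊎
              (2 ℕ.* m ≤ n × Shape shellBox-h (m , n) s)
shell-shape m n s (inj₁ (n≤2m , k , inj₁ p)) = inj₁ (n≤2m , (edge , k) ,
  unrotate⇒turn (shellBox-g edge) (toℕ k)
    (rectangle-cong (high-lower m n) (three-times m n) (mid-lower m n) (high-lower m n) p))
shell-shape m n s (inj₁ (n≤2m , k , inj₂ p)) = inj₁ (n≤2m , (corner , k) ,
  unrotate⇒turn (shellBox-g corner) (toℕ k)
    (rectangle-cong (multiple⊖ 3 m n) (high-upper m n) (multiple⊖ 3 m n) (high-upper m n) p))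
shell-shape m n s (inj₂ ((2m≤n , _) , k , inj₁ p)) = inj₂ (2m≤n , (edge , k) ,
  unrotate⇒turn (shellBox-h edge) (toℕ k)
    (rectangle-cong (multiple⊖multiple m n) (high-upper m n) (⊖multiple 3 m n) (multiple⊖ 3 m n) p))
shell-shape m n s (inj₂ ((2m≤n , _) , k , inj₂ p)) = inj₂ (2m≤n , (corner , k) ,
  unrotate⇒turn (shellBox-h corner) (toℕ k)
    (rectangle-cong (high-lower m n) (multiple⊖ 5 m n) (high-lower m n) (multiple⊖ 5 m n) p))

seed-of-shape : ∀ {m n} → m ≤ n → ∀ G s → vec G ≡ U g · vec (m , n) × Shape shellBox-g G s ⊎
                vec G ≡ U h · vec (m , n) × Shape shellBox-h G s → FromSeed (m , n) G s
seed-of-shape m≤n G s (inj₁ (G≡ , c , p)) = seed g shellBox-g shell-g-to-hole m≤n G G≡ c s p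
seed-of-shape m≤n G s (inj₂ (G≡ , c , p)) = seed h shellBox-h shell-h-to-hole m≤n G G≡ c s p

-- A shell of the other shape forces m = 0, where g and h yield the same frame.
shell-seed-g : ∀ {m n} → m ≤ n → let G = liftFrame g (m , n) in
               ∀ s → s ∈ Shell G → FromSeed (m , n) G s
shell-seed-g {m} {n} m≤n s p = seed-of-shape m≤n G s (choose (shell-shape n _ s p))
  where
  G = liftFrame g (m , n)
  m≡0 : 2 ℕ.* n ≤ 2 ℕ.* n ℕ.∸ m → m ≡ 0
  m≡0 2n≤ = ℕ.n≤0⇒n≡0 (ℕ.+-cancelˡ-≤ (2 ℕ.* n) m 0 (begin
    2 ℕ.* n ℕ.+ m              ≤⟨ ℕ.+-monoˡ-≤ m 2n≤ ⟩
    (2 ℕ.* n ℕ.∸ m) ℕ.+ m      ≡⟨ ℕ.m∸n+n≡m (ℕ.≤-trans m≤n (ℕ.m≤m+n n (n ℕ.+ 0))) ⟩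
    2 ℕ.* n                    ≡⟨ ℕ.+-identityʳ (2 ℕ.* n) ⟨
    2 ℕ.* n ℕ.+ 0              ∎))
    where open ℕ.≤-Reasoning
  choose : _ → _
  choose (inj₁ (_ , q))   = inj₁ (lift-vec g m≤n , q)
  choose (inj₂ (2n≤ , q)) = inj₂
    (subst (λ m → vec (liftFrame g (m , n)) ≡ U h · vec (m , n)) (sym (m≡0 2n≤))
      (lift-vec h {0} {n} z≤n) , q)

shell-seed-h : ∀ {m n} → m ≤ n → let G = liftFrame h (m , n) in
               ∀ s → s ∈ Shell G → FromSeed (m , n) G s
shell-seed-h {m} {n} m≤n s p = seed-of-shape m≤n G s (choose (shell-shape n _ s p))
  where
  G = liftFrame h (m , n)
  m≡0 : m ℕ.+ 2 ℕ.* n ≤ 2 ℕ.* n → m ≡ 0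
  m≡0 ≤2n = ℕ.n≤0⇒n≡0 (ℕ.+-cancelʳ-≤ (2 ℕ.* n) m 0 ≤2n)
  choose : _ → _
  choose (inj₂ (_ , q))   = inj₂ (lift-vec h m≤n , q)
  choose (inj₁ (≤2n , q)) = inj₁
    (subst (λ m → vec (liftFrame h (m , n)) ≡ U g · vec (m , n)) (sym (m≡0 ≤2n))
      (lift-vec g {0} {n} z≤n) , q)

module ShellCycle (x : Lifting) (fromHole : FromHole x) (r : List Lifting)
                  (shell-seed : ∀ s → s ∈ Shell (frame (x ∷ r)) →
                                FromSeed (frame r) (frame (x ∷ r)) s) where

  private
    v = vec (frame (x ∷ r))

    -- Lifts of squares of the hole that are joined by a move are lifts of the
    -- same square, because the squares of the hole are isolated.
    same-seed : ∀ d i j s s′ {a b} →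
                InBox hole (vec (frame r)) s → InBox hole (vec (frame r)) s′ →
                a ≡ s ⊕ V i · v → b ≡ s′ ⊕ V j · v → b ⊖ a ≡ A d · v → s′ ≡ s
    same-seed d i j s s′ {a} {b} s∈ s′∈ a≡ b≡ δ = conclude (moves-descend x d i j
      (possible (frame-≤ r) (box i ⋆ U x) (A d *ᴹ U x) (box j ⋆ U x)
        (pull (box i) (U x) {v = vec (frame r)} (subst₂ (λ v a → InBox (box i) v a) v≡ (sym a≡)
          (into-section x r hole i s (fromHole i) s∈)))
        (pull (box j) (U x) {v = vec (frame r)}
          (subst₂ (λ v b → InBox (box j) v b) v≡ (trans (sym b≡) b≡′)
          (into-section x r hole j s′ (fromHole j) s′∈)))))
      where
      v≡ : v ≡ U x · vec (frame r)
      v≡ = lift-vec x (frame-≤ r)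
      b≡′ : b ≡ a ⊕ (A d *ᴹ U x) · vec (frame r)
      b≡′ = trans (⊖⇒⊕ a b _ δ)
        (cong (a ⊕_) (trans (cong (A d ·_) v≡) (sym (·-*ᴹ (A d) (U x) (vec (frame r))))))
      step′ : s′ ⊖ s ≡ (A d +ᴹ V i +ᴹ (-ᴹ V j)) · v
      step′ = unlift v (A d) (V i) (V j) s s′ a≡ b≡ δ
      conclude : Descends x (A d +ᴹ V i +ᴹ (-ᴹ V j)) → s′ ≡ s
      conclude (inj₁ M≡0) = sym (⊖-zero s s′ (trans step′ (trans (cong (_· v) M≡0) (0-· v))))
      conclude (inj₂ (d′ , M≡)) = contradiction (possible (frame-≤ r) hole (A d′) board s∈
          (widen (frame-≤ r) hole board hole⊆board
            (subst (InBox hole (vec (frame r))) (⊖⇒⊕ s s′ _ move) s′∈)))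
        (hole-no-exit d′)
        where
        move : s′ ⊖ s ≡ A d′ · vec (frame r)
        move = trans step′ (trans (cong (_· v) M≡)
          (trans (·-*ᴹ (A d′) (T x) v) (cong (A d′ ·_) (unlift-vec x (frame-≤ r)))))

    constant : ∀ {n} (σ : Fin (suc n) → Square) → (∀ i → σ (next i) ≡ σ i) → ∀ i → σ i ≡ σ Fin.zero
    constant σ σ-next = <-weakInduction (λ i → σ i ≡ σ Fin.zero) refl
      (λ i eq → trans (cong σ (sym (next-inject₁ i))) (trans (σ-next (inject₁ i)) eq))

  Seeded-squares : ∀ {n} → (Fin n → Square) → Square → Set
  Seeded-squares sq s₀ = ∀ s → (∃[ i ] sq i ≡ s) ⇔ (∃[ c ] s ≡ s₀ ⊕ V c · v)

  -- All squares of the cycle are lifts of one square of the hole, and being eight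
  -- in number they are all of its lifts.
  eight-squares : ∀ {p q n} → (p , q) ≡ frame (x ∷ r) → n ≡ 8 → (sq : Fin n → Square) →
                  (∀ {i j} → sq i ≡ sq j → i ≡ j) →
                  (∀ i → Adjacent p q (sq i) (sq (next i))) → (∀ i → sq i ∈ Shell (p , q)) →
                  ∃[ s₀ ] (InBox hole (vec (frame r)) s₀ × Seeded-squares sq s₀)
  eight-squares refl refl sq injective adjacent in-shell =
    s₀ , proj₁ (proj₂ (proj₂ (σ Fin.zero))) , λ s → mk⇔ (λ { (i , refl) → c i , sq≡ i }) (onto s)
    where
    σ = λ i → shell-seed (sq i) (in-shell i)
    c = λ i → proj₁ (σ i)
    s₀ = proj₁ (proj₂ (σ Fin.zero))
    same : ∀ i → proj₁ (proj₂ (σ (next i))) ≡ proj₁ (proj₂ (σ i))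
    same i = let (d , δ) = adjacent⇒direction (sq i) (sq (next i)) (adjacent i) in
      same-seed d (c i) (c (next i)) _ _
        (proj₁ (proj₂ (proj₂ (σ i)))) (proj₁ (proj₂ (proj₂ (σ (next i)))))
        (proj₂ (proj₂ (proj₂ (σ i)))) (proj₂ (proj₂ (proj₂ (σ (next i))))) δ
    sq≡ : ∀ i → sq i ≡ s₀ ⊕ V (c i) · v
    sq≡ i = trans (proj₂ (proj₂ (proj₂ (σ i))))
      (cong (_⊕ V (c i) · v) (constant (λ i → proj₁ (proj₂ (σ i))) same i))
    c-injective : ∀ i j → encode (c i) ≡ encode (c j) → i ≡ j
    c-injective i j eq = injective (trans (sq≡ i)
      (trans (cong (λ c → s₀ ⊕ V c · v) (encode-injective (c i) (c j) eq)) (sym (sq≡ j))))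
    onto : ∀ s → ∃[ c′ ] s ≡ s₀ ⊕ V c′ · v → ∃[ i ] sq i ≡ s
    onto s (c′ , s≡) = let (i , eq) = injective⇒onto (encode ∘ c) c-injective (encode c′) in
      i , trans (sq≡ i)
        (trans (cong (λ c → s₀ ⊕ V c · v) (encode-injective (c i) c′ eq)) (sym s≡))

------------------------------------------------------------------------
-- Cycles with a descent

frame-from-12 : ∀ e → frame (e ++ g ∷ []) ≡ liftFrames e (1 , 2)
frame-from-12 e = foldr-++ liftFrame (0 , 1) e (g ∷ [])

frame-distinct : ∀ w → proj₁ (frame w) ≢ proj₂ (frame w)
frame-distinct w m≡n with frame-odd w
... | k , eq = even≢odd 0ℤ k (trans (sym (trans
    (cong (λ m → -1ℤ ℤ.* ℤ.+ m ℤ.+ 1ℤ ℤ.* ℤ.+ proj₂ (frame w)) m≡n)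
    (lemma (ℤ.+ proj₂ (frame w))))) eq)
  where
  lemma : ∀ n → -1ℤ ℤ.* n ℤ.+ 1ℤ ℤ.* n ≡ 0ℤ
  lemma = solve-∀

-- The frame F is obtained from the frame r by a lifting x that opens its hole
-- into the shell of F.
record Opening (F : Proportions) : Set where
  field
    x          : Lifting
    r          : List Lifting
    frame≡     : frame (x ∷ r) ≡ F
    fromHole   : FromHole x
    shell-seed : ∀ s → s ∈ Shell (frame (x ∷ r)) →
                 FromSeed (frame r) (frame (x ∷ r)) s

-- The last lifting is not f, which would give n > 3m.
opening : ∀ rest {m n} → liftFrames rest (1 , 2) ≡ (m , n) → n ≤ 3 ℕ.* m → Opening (m , n)
opening []         refl _    = record
  { x = g ; r = [] ; frame≡ = refl ; fromHole = fromHole-g ; shell-seed = shell-seed-g z≤n }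
opening (g ∷ rest) refl _    = record
  { x = g ; r = r ; frame≡ = cong (liftFrame g) (frame-from-12 rest) ; fromHole = fromHole-g
  ; shell-seed = shell-seed-g (frame-≤ r) }
  where r = rest ++ g ∷ []
opening (h ∷ rest) refl _    = record
  { x = h ; r = r ; frame≡ = cong (liftFrame h) (frame-from-12 rest) ; fromHole = fromHole-h
  ; shell-seed = shell-seed-h (frame-≤ r) }
  where r = rest ++ g ∷ []
opening (f ∷ rest) refl n≤3m = contradiction (ℕ.≤-antisym (frame-≤ r) n≤m) (frame-distinct r)
  where
  r = rest ++ g ∷ []
  n≤m : proj₂ (frame r) ≤ proj₁ (frame r)
  n≤m = subst (λ F → proj₂ F ≤ proj₁ F) (sym (frame-from-12 rest))
    (ℕ.+-cancelˡ-≤ (2 ℕ.* m) n m (ℕ.≤-trans n≤3m (ℕ.≤-reflexive (lemma m))))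
    where
    m = proj₁ (liftFrames rest (1 , 2))
    n = proj₂ (liftFrames rest (1 , 2))
    lemma : ∀ m → 3 ℕ.* m ≡ 2 ℕ.* m ℕ.+ m
    lemma m = trans (ℕ.+-comm m (2 ℕ.* m)) refl

descent-chart : ∀ {L} (C : BoardCycle L) e → IsDescent C e →
                Chart (BoardCycle.cycle C) (λ X → ∃[ c ] Reach e c X)
descent-chart {L} C e D =
  build shell-descent (opening rest shell-descent (proj₁ isShell)) shell isShell lifted⇔
  where
  open IsDescent D renaming (lifted to lifted⇔)
  open Leaper L using (p; q)
  build : ∀ {m n} → liftFrames rest (1 , 2) ≡ (m , n) → Opening (m , n) →
          (K : Cycle m n) → IsShellCycle K →
          (∀ s → squares (BoardCycle.cycle C) (s ⊕ BoardCycle.centre C) ⇔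
                 lifts e (m , n) (squares K) s) →
          Chart (BoardCycle.cycle C) (λ X → ∃[ c ] Reach e c X)
  build rest≡ record { x = x ; r = r ; frame≡ = refl
                     ; fromHole = fromHole ; shell-seed = shell-seed } K
        (_ , size≡8 , in-shell) lifted⇔ =
    let (s₀ , s₀∈hole , S⇔) = ShellCycle.eight-squares x fromHole r shell-seed refl size≡8
                                (Cycle.square K) (Cycle.injective K) (Cycle.adjacent K) in-shell
    in Seeded.chart x fromHole r s₀ s₀∈hole (squares K) S⇔ C e w≡ lifted⇔
    where
    w≡ : frame (e ++ x ∷ r) ≡ (p , q)
    w≡ = begin
      frame (e ++ x ∷ r)                 ≡⟨ foldr-++ liftFrame (0 , 1) e (x ∷ r) ⟩
      liftFrames e (frame (x ∷ r))       ≡⟨ cong (liftFrames e) rest≡ ⟨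
      liftFrames e (liftFrames rest (1 , 2)) ≡⟨ foldr-++ liftFrame (1 , 2) e rest ⟨
      liftFrames (e ++ rest) (1 , 2)     ≡⟨ leaper-descent ⟩
      (p , q)                            ∎
      where open ≡-Reasoning

------------------------------------------------------------------------
-- Even continued fractions

Terms : Set
Terms = List (Sign × ℕ)

EvenTerms : Terms → Set
EvenTerms = All (λ (_ , c′) → 2 ∣ c′ × 0 < c′)

ι : ℕ → ℚ
ι c = ℤ.+ c ℚ./ 1

-- The value of [ c ± , … ].
evaluate : ℕ → Terms → ℚ
evaluate c []              = ι c
evaluate c ((s , c′) ∷ cs) = addSigned s (ι c) (reciprocal (evaluate c′ cs))

-- The recursive evaluation inside value has no name of its own and carries the
-- whole continued fraction along.  Abstracting reciprocal and the list of terms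
-- lets unification recover that function in the statement of go≡evaluate.
value≡evaluate : ∀ c cs → value (cf c cs) ≡ evaluate c cs
go≡evaluate : ∀ c₀ cs₀ c cs → _ ≡ evaluate c cs
value≡evaluate c [] = refl
value≡evaluate c ((s , c′) ∷ cs) with reciprocal | (s , c′) ∷ cs
... | ρ | cs₀ = cong (λ r → addSigned s (ι c) (ρ r)) (go≡evaluate c cs₀ c′ cs)
go≡evaluate c₀ cs₀ c []              = refl
go≡evaluate c₀ cs₀ c ((s , c′) ∷ cs) =
  cong (λ r → addSigned s (ι c) (reciprocal r)) (go≡evaluate c₀ cs₀ c′ cs)

-- The part of the value after the head.
fraction : Terms → ℚ
fraction []                   = 0ℚ
fraction ((Sign.+ , c) ∷ cs) = reciprocal (evaluate c cs)
fraction ((Sign.- , c) ∷ cs) = ℚ.- reciprocal (evaluate c cs)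

evaluate≡ : ∀ c cs → evaluate c cs ≡ ι c ℚ.+ fraction cs
evaluate≡ c []                   = sym (ℚ.+-identityʳ (ι c))
evaluate≡ c ((Sign.+ , _) ∷ _) = refl
evaluate≡ c ((Sign.- , _) ∷ _) = refl

reciprocal-positive : ∀ x → 0ℚ ℚ.< x → 0ℚ ℚ.< reciprocal x
reciprocal-positive x 0<x = go x (ℚ.positive 0<x)
  where
  go : ∀ x → ℚ.Positive x → 0ℚ ℚ.< reciprocal x
  go x@(mkℚ (ℤ.+[1+ _ ]) _ _) _ = ℚ.positive⁻¹ (ℚ.1/ x) ⦃ ℚ.1/pos⇒pos x ⦄

reciprocal-inverse : ∀ x → 0ℚ ℚ.< x → x ℚ.* reciprocal x ≡ 1ℚ
reciprocal-inverse x 0<x = go x (ℚ.positive 0<x)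
  where
  go : ∀ x → ℚ.Positive x → x ℚ.* reciprocal x ≡ 1ℚ
  go x@(mkℚ (ℤ.+[1+ _ ]) _ _) _ = ℚ.*-inverseʳ x

reciprocal-involutive : ∀ x → 0ℚ ℚ.< x → reciprocal (reciprocal x) ≡ x
reciprocal-involutive x 0<x = go x (ℚ.positive 0<x)
  where
  go : ∀ x → ℚ.Positive x → reciprocal (reciprocal x) ≡ x
  go x@(mkℚ (ℤ.+[1+ _ ]) _ _) _ = refl

0<1 : 0ℚ ℚ.< 1ℚ
0<1 = ℚ.positive⁻¹ 1ℚ

reciprocal<1 : ∀ x → 1ℚ ℚ.< x → reciprocal x ℚ.< 1ℚ
reciprocal<1 x 1<x = begin-strict
  reciprocal x          ≡⟨ ℚ.*-identityˡ (reciprocal x) ⟨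
  1ℚ ℚ.* reciprocal x   <⟨ ℚ.*-monoˡ-<-pos (reciprocal x)
                             ⦃ ℚ.positive (reciprocal-positive x 0<x) ⦄ 1<x ⟩
  x ℚ.* reciprocal x    ≡⟨ reciprocal-inverse x 0<x ⟩
  1ℚ                    ∎
  where
  open ℚ.≤-Reasoning
  0<x = ℚ.<-trans 0<1 1<x

ι-gap : ∀ {c d} → c ℕ.+ 2 ≤ d → ι c ℚ.+ ι 2 ℚ.≤ ι d
ι-gap {c} {d} c+2≤d = ℚ.toℚᵘ-cancel-≤ (begin
  ℚ.toℚᵘ (ι c ℚ.+ ι 2)                    ≃⟨ ℚ.toℚᵘ-homo-+ (ι c) (ι 2) ⟩
  ℚ.toℚᵘ (ι c) ℚᵘ.+ ℚ.toℚᵘ (ι 2)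
    ≃⟨ ℚᵘ.+-cong (ℚ.toℚᵘ-fromℚᵘ (ℚᵘ.mkℚᵘ (ℤ.+ c) 0))
                 (ℚ.toℚᵘ-fromℚᵘ (ℚᵘ.mkℚᵘ (ℤ.+ 2) 0)) ⟩
  ℚᵘ.mkℚᵘ (ℤ.+ c) 0 ℚᵘ.+ ℚᵘ.mkℚᵘ (ℤ.+ 2) 0 ≤⟨ ℚᵘ.*≤* (subst₂ ℤ._≤_
    (sym (trans (ℤ.*-identityʳ _) (cong (ℤ._+ ℤ.+ 2) (ℤ.*-identityʳ (ℤ.+ c)))))
    (sym (ℤ.*-identityʳ (ℤ.+ d))) (ℤ.+≤+ c+2≤d)) ⟩
  ℚᵘ.mkℚᵘ (ℤ.+ d) 0                       ≃⟨ ℚ.toℚᵘ-fromℚᵘ (ℚᵘ.mkℚᵘ (ℤ.+ d) 0) ⟨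
  ℚ.toℚᵘ (ι d)                            ∎)
  where open ℚᵘ.≤-Reasoning

even-gap : ∀ {c d} → 2 ∣ c → 2 ∣ d → c < d → c ℕ.+ 2 ≤ d
even-gap (divides-refl a) (divides-refl b) a2<b2 =
  subst (_≤ b ℕ.* 2) (ℕ.+-comm 2 (a ℕ.* 2)) (ℕ.*-monoˡ-≤ 2 (ℕ.*-cancelʳ-< 2 a b a2<b2))

fraction-bounds : ∀ cs → EvenTerms cs → ℚ.- 1ℚ ℚ.< fraction cs × fraction cs ℚ.< 1ℚ
1<evaluate : ∀ c cs → 2 ∣ c → 0 < c → EvenTerms cs → 1ℚ ℚ.< evaluate c cs
fraction-bounds []                  _ = ℚ.neg-antimono-< 0<1 , 0<1
fraction-bounds ((Sign.+ , c) ∷ cs) ((2∣c , 0<c) ∷ even) =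
  ℚ.<-trans (ℚ.neg-antimono-< 0<1) (reciprocal-positive x (ℚ.<-trans 0<1 1<x)) , reciprocal<1 x 1<x
  where
  x = evaluate c cs
  1<x = 1<evaluate c cs 2∣c 0<c even
fraction-bounds ((Sign.- , c) ∷ cs) ((2∣c , 0<c) ∷ even) =
  ℚ.neg-antimono-< (reciprocal<1 x 1<x) ,
  ℚ.<-trans (ℚ.neg-antimono-< (reciprocal-positive x (ℚ.<-trans 0<1 1<x))) 0<1
  where
  x = evaluate c cs
  1<x = 1<evaluate c cs 2∣c 0<c even
1<evaluate c cs 2∣c 0<c even = subst (1ℚ ℚ.<_) (sym (evaluate≡ c cs))
  (ℚ.+-mono-≤-< {ι 2} {ι c} 2≤c (proj₁ (fraction-bounds cs even)))
  where
  2≤c : ι 2 ℚ.≤ ι c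
  2≤c = subst (ℚ._≤ ι c) (ℚ.+-identityˡ (ι 2)) (ι-gap {0} (even-gap (divides-refl 0) 2∣c 0<c))

-- Distinct even heads differ by at least two, which the fractions cannot bridge.
smaller-head : ∀ c d cs ds → 2 ∣ c → 2 ∣ d → EvenTerms cs → EvenTerms ds → c < d →
               evaluate c cs ℚ.< evaluate d ds
smaller-head c d cs ds 2∣c 2∣d even even′ c<d = begin-strict
  evaluate c cs               ≡⟨ evaluate≡ c cs ⟩
  ι c ℚ.+ fraction cs         <⟨ ℚ.+-monoʳ-< (ι c) (proj₂ (fraction-bounds cs even)) ⟩
  ι c ℚ.+ 1ℚ                  ≡⟨ ℚ.+-assoc (ι c) (ι 2) (ℚ.- 1ℚ) ⟨
  ι c ℚ.+ ι 2 ℚ.- 1ℚ          <⟨ ℚ.+-mono-≤-< (ι-gap (even-gap 2∣c 2∣d c<d))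
                                              (proj₁ (fraction-bounds ds even′)) ⟩
  ι d ℚ.+ fraction ds         ≡⟨ evaluate≡ d ds ⟨
  evaluate d ds               ∎
  where open ℚ.≤-Reasoning

evaluate-injective : ∀ c cs d ds → 2 ∣ c → EvenTerms cs → 2 ∣ d → EvenTerms ds →
                     evaluate c cs ≡ evaluate d ds → cf c cs ≡ cf d ds
fraction-injective : ∀ cs ds → EvenTerms cs → EvenTerms ds → fraction cs ≡ fraction ds → cs ≡ ds
evaluate-injective c cs d ds 2∣c even 2∣d even′ eq with ℕ.<-cmp c d
... | tri< c<d _ _ = contradiction eq (ℚ.<⇒≢ (smaller-head c d cs ds 2∣c 2∣d even even′ c<d))
... | tri> _ _ d<c = contradiction (sym eq) (ℚ.<⇒≢ (smaller-head d c ds cs 2∣d 2∣c even′ even d<c))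
... | tri≈ _ refl _ = cong (cf c) (fraction-injective cs ds even even′
        (∙-cancelˡ ℚ.+-0-abelianGroup (ι c) (fraction cs) (fraction ds)
          (trans (sym (evaluate≡ c cs)) (trans eq (evaluate≡ c ds)))))
fraction-injective cs ds even even′ eq = go cs ds even even′ eq
  where
  0<reciprocal : ∀ c cs → EvenTerms ((Sign.+ , c) ∷ cs) → 0ℚ ℚ.< reciprocal (evaluate c cs)
  0<reciprocal c cs ((2∣c , 0<c) ∷ even) =
    reciprocal-positive (evaluate c cs) (ℚ.<-trans 0<1 (1<evaluate c cs 2∣c 0<c even))
  reciprocal<0 : ∀ c cs → EvenTerms ((Sign.- , c) ∷ cs) → ℚ.- reciprocal (evaluate c cs) ℚ.< 0ℚ
  reciprocal<0 c cs (e ∷ even) = ℚ.neg-antimono-< (0<reciprocal c cs (e ∷ even))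
  same : ∀ s c cs d ds → EvenTerms ((s , c) ∷ cs) → EvenTerms ((s , d) ∷ ds) →
         reciprocal (evaluate c cs) ≡ reciprocal (evaluate d ds) → (s , c) ∷ cs ≡ (s , d) ∷ ds
  same s c cs d ds ((2∣c , 0<c) ∷ even) ((2∣d , 0<d) ∷ even′) eq =
    cong (λ (cf c cs) → (s , c) ∷ cs) (evaluate-injective c cs d ds 2∣c even 2∣d even′
      (trans (sym (reciprocal-involutive x (ℚ.<-trans 0<1 (1<evaluate c cs 2∣c 0<c even))))
        (trans (cong reciprocal eq)
          (reciprocal-involutive y (ℚ.<-trans 0<1 (1<evaluate d ds 2∣d 0<d even′))))))
    where
    x = evaluate c cs
    y = evaluate d ds
  go : ∀ cs ds → EvenTerms cs → EvenTerms ds → fraction cs ≡ fraction ds → cs ≡ ds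
  go []                  []                  _    _     _  = refl
  go []                  ((Sign.+ , d) ∷ ds) _    even′ eq =
    contradiction eq (ℚ.<⇒≢ (0<reciprocal d ds even′))
  go []                  ((Sign.- , d) ∷ ds) _    even′ eq =
    contradiction (sym eq) (ℚ.<⇒≢ (reciprocal<0 d ds even′))
  go ((Sign.+ , c) ∷ cs) []                  even _     eq =
    contradiction (sym eq) (ℚ.<⇒≢ (0<reciprocal c cs even))
  go ((Sign.- , c) ∷ cs) []                  even _     eq =
    contradiction eq (ℚ.<⇒≢ (reciprocal<0 c cs even))
  go ((Sign.+ , c) ∷ cs) ((Sign.+ , d) ∷ ds) even even′ eq =
    same Sign.+ c cs d ds even even′ eq
  go ((Sign.- , c) ∷ cs) ((Sign.- , d) ∷ ds) even even′ eq =
    same Sign.- c cs d ds even even′ (ℚ.neg-injective eq)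
  go ((Sign.+ , c) ∷ cs) ((Sign.- , d) ∷ ds) even even′ eq =
    contradiction (sym eq) (ℚ.<⇒≢ (ℚ.<-trans (reciprocal<0 d ds even′) (0<reciprocal c cs even)))
  go ((Sign.- , c) ∷ cs) ((Sign.+ , d) ∷ ds) even even′ eq =
    contradiction eq (ℚ.<⇒≢ (ℚ.<-trans (reciprocal<0 c cs even) (0<reciprocal d ds even′)))

value-injective : ∀ c d → IsEven c → IsEven d → value c ≡ value d → c ≡ d
value-injective (cf c cs) (cf d ds) (2∣c , even) (2∣d , even′) eq =
  evaluate-injective c cs d ds 2∣c even 2∣d even′
    (trans (sym (value≡evaluate c cs)) (trans eq (value≡evaluate d ds)))

convergent-even : ∀ k c → IsEven c → IsEven (convergent k c)
convergent-even k (cf c cs) (2∣c , even) = 2∣c , All.take⁺ (k ℕ.∸ 1) even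

------------------------------------------------------------------------
-- Direction graphs of cycles and their descents

theorem9 : (∀ (L : Leaper) (C : BoardCycle L) →
    Trivial (BoardCycle.cycle C) × IsDirectionGraph (extracted (BoardCycle.cycle C)))
    ×
    (∀ (L L′ : Leaper) (C : BoardCycle L) (C′ : BoardCycle L′) (e : List Lifting) →
    IsDescent C e → IsDescent C′ e →
    extracted (BoardCycle.cycle C) ≅ extracted (BoardCycle.cycle C′))
    ×
    (∀ (L L′ : Leaper) (c c′ : ContinuedFraction) → Represents c L → Represents c′ L′ →
    ∀ (C : BoardCycle L) (C′ : BoardCycle L′) (k k′ : ℕ) → IsType c k C → IsType c′ k′ C′ →
    value (convergent k c) ≡ value (convergent k′ c′) →
    extracted (BoardCycle.cycle C) ≅ extracted (BoardCycle.cycle C′))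
theorem9 = direction-graph , same-descent , same-convergent
  where
  direction-graph : ∀ (L : Leaper) (C : BoardCycle L) →
    Trivial (BoardCycle.cycle C) × IsDirectionGraph (extracted (BoardCycle.cycle C))
  direction-graph L C = potential⇒trivial (BoardCycle.cycle C) (boardCycle-potential C) ,
                        potential⇒directionGraph (BoardCycle.cycle C) (boardCycle-potential C)

  same-descent : ∀ (L L′ : Leaper) (C : BoardCycle L) (C′ : BoardCycle L′) (e : List Lifting) →
    IsDescent C e → IsDescent C′ e →
    extracted (BoardCycle.cycle C) ≅ extracted (BoardCycle.cycle C′)
  same-descent L L′ C C′ e D D′ = charts⇒≅ (descent-chart C e D) (descent-chart C′ e D′)

  same-convergent : ∀ (L L′ : Leaper) (c c′ : ContinuedFraction) →
    Represents c L → Represents c′ L′ →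
    ∀ (C : BoardCycle L) (C′ : BoardCycle L′) (k k′ : ℕ) → IsType c k C → IsType c′ k′ C′ →
    value (convergent k c) ≡ value (convergent k′ c′) →
    extracted (BoardCycle.cycle C) ≅ extracted (BoardCycle.cycle C′)
  same-convergent L L′ c c′ (even , _) (even′ , _) C C′ k k′ (_ , D) (_ , D′) eq =
    same-descent L L′ C C′ (descentString (convergent k c)) D
      (subst (λ d → IsDescent C′ (descentString d)) (sym same) D′)
    where
    same : convergent k c ≡ convergent k′ c′
    same = value-injective (convergent k c) (convergent k′ c′)
      (convergent-even k c even) (convergent-even k′ c′ even′) eq
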